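{- Let $G$ be a unicyclic graph of order $n$ with girth $g$. Then $$SO(G)\leq 2\sqrt{(n-g+2)^2+4}+(n-g)\sqrt{(n-g+2)^2+1}+2\sqrt{2}(g-2),$$ with equality if and only if $G$ is isomorphic to the graph obtained by attaching $n-g$ pendent edges to a single vertex of the cycle $C_g$.
   Context: All graphs are finite and simple. A unicyclic graph is a connected graph containing exactly one cycle; its girth is the length of that cycle. For a graph $G$ with edge set $E(G)$ and vertex degrees $d_G(v)$, the Sombor index is $SO(G)=\sum_{uv\in E(G)}\sqrt{d_G(u)^2+d_G(v)^2}$. Attaching a pendent edge to a vertex $w$ means adding a new vertex adjacent only to $w$. -}

module Defs where

open import Data.Nat as ℕ using (ℕ; zero; suc; _+_; _*_; _∸_; _≡ᵇ_; _<ᵇ_; _≤ᵇ_)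
open import Data.Bool using (Bool; true; false; _∧_; _∨_; if_then_else_)
open import Data.Fin using (Fin; toℕ)
open import Data.List using (List; []; _∷_; [_]; _++_; length; map; concatMap; allFin; zip)
open import Data.Nat.ListAction using (sum)
open import Data.List.Relation.Unary.All using (All; []; _∷_)
open import Data.List.Relation.Unary.Unique.Propositional using (Unique)
open import Data.List.Membership.Propositional using (_∈_)
open import Data.Product using (Σ; _×_; _,_; ∃)
open import Data.Sum using (_⊎_)
open import Data.Integer using (+_)
open import Data.Rational as ℚ using (ℚ; 0ℚ; _/_)
open import Function.Bundles using (_↔_; _⇔_; Inverse)
open import Relation.Binary.PropositionalEquality using (_≡_)

record Graph (n : ℕ) : Set where
  field
    adj    : Fin n → Fin n → Bool
    sym    : ∀ u v → adj u v ≡ adj v u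
    irrefl : ∀ v → adj v v ≡ false
open Graph public

Adj : ∀ {n} → Graph n → Fin n → Fin n → Set
Adj G u v = adj G u v ≡ true

degree : ∀ {n} → Graph n → Fin n → ℕ
degree {n} G v = sum (map (λ u → if adj G v u then 1 else 0) (allFin n))

data Reachable {n} (G : Graph n) : Fin n → Fin n → Set where
  here : ∀ {v} → Reachable G v v
  step : ∀ {u w v} → Adj G u w → Reachable G w v → Reachable G u v

Connected : ∀ {n} → Graph n → Set
Connected {n} G = ∀ (u v : Fin n) → Reachable G u v

cyclePairs : ∀ {A : Set} → List A → List (A × A)
cyclePairs []       = []
cyclePairs (x ∷ xs) = zip (x ∷ xs) (xs ++ [ x ])

IsCycle : ∀ {n} → Graph n → List (Fin n) → Set
IsCycle G vs = Unique vs × 3 ℕ.≤ length vs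
             × All (λ p → Adj G (Data.Product.proj₁ p) (Data.Product.proj₂ p)) (cyclePairs vs)

CycleEdge : ∀ {n} → List (Fin n) → Fin n → Fin n → Set
CycleEdge vs u v = (u , v) ∈ cyclePairs vs ⊎ (v , u) ∈ cyclePairs vs

Unicyclic : ∀ {n} → Graph n → Set
Unicyclic {n} G = Connected G
                × (∃ λ vs → IsCycle G vs)
                × (∀ vs ws → IsCycle G vs → IsCycle G ws →
                     ∀ u v → (CycleEdge vs u v → CycleEdge ws u v)
                           × (CycleEdge ws u v → CycleEdge vs u v))

-- Nonnegative linear combinations of square roots of naturals:
-- a list of (c , r) denotes  Σ c · √r.  Real-number comparison of
-- such quantities is expressed exactly via rational approximations
-- (Dedekind-cut style): rational lower bounds p of √r are those with
-- p ≤ 0 or p² ≤ r; rational upper bounds q are those with 0 ≤ q, r ≤ q².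

SqrtSum : Set
SqrtSum = List (ℕ × ℕ)

ℚ[_] : ℕ → ℚ
ℚ[ r ] = + r / 1

LowerBound : ℕ → ℚ → Set
LowerBound r p = p ℚ.≤ 0ℚ ⊎ p ℚ.* p ℚ.≤ ℚ[ r ]

UpperBound : ℕ → ℚ → Set
UpperBound r q = 0ℚ ℚ.≤ q × ℚ[ r ] ℚ.≤ q ℚ.* q

Lowers : SqrtSum → Set
Lowers xs = All (λ t → Σ ℚ (LowerBound (Data.Product.proj₂ t))) xs

Uppers : SqrtSum → Set
Uppers xs = All (λ t → Σ ℚ (UpperBound (Data.Product.proj₂ t))) xs

evalApprox : ∀ {P : ℕ → ℚ → Set} {xs : SqrtSum} →
             All (λ t → Σ ℚ (P (Data.Product.proj₂ t))) xs → ℚ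
evalApprox [] = 0ℚ
evalApprox {xs = (c , _) ∷ _} ((p , _) ∷ ps) = ℚ[ c ] ℚ.* p ℚ.+ evalApprox ps

_≤√_ : SqrtSum → SqrtSum → Set
xs ≤√ ys = (ls : Lowers xs) (us : Uppers ys) → evalApprox ls ℚ.≤ evalApprox us

_≈√_ : SqrtSum → SqrtSum → Set
xs ≈√ ys = (xs ≤√ ys) × (ys ≤√ xs)

SO : ∀ {n} → Graph n → SqrtSum
SO {n} G = concatMap (λ u → concatMap (λ v →
             if (toℕ u <ᵇ toℕ v) ∧ adj G u v
             then [ (1 , degree G u * degree G u + degree G v * degree G v) ]
             else []) (allFin n)) (allFin n)

SObound : ℕ → ℕ → SqrtSum
SObound n g = (2 , (n ∸ g + 2) * (n ∸ g + 2) + 4)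
            ∷ (n ∸ g , (n ∸ g + 2) * (n ∸ g + 2) + 1)
            ∷ (2 * (g ∸ 2) , 2)
            ∷ []

-- The extremal graph on vertices 0 … n-1: the cycle C_g on 0 … g-1
-- (i ~ i+1, and 0 ~ g-1), with the n-g vertices g … n-1 each attached
-- by a pendent edge to the cycle vertex 0.

cycleWithPendentsAdj : ℕ → ℕ → ℕ → Bool
cycleWithPendentsAdj g i j =
     ((i <ᵇ g) ∧ (j <ᵇ g) ∧
        ((suc i ≡ᵇ j) ∨ (suc j ≡ᵇ i)
         ∨ ((i ≡ᵇ 0) ∧ (j ≡ᵇ g ∸ 1)) ∨ ((j ≡ᵇ 0) ∧ (i ≡ᵇ g ∸ 1))))
  ∨ ((i ≡ᵇ 0) ∧ (g ≤ᵇ j))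
  ∨ ((j ≡ᵇ 0) ∧ (g ≤ᵇ i))

IsoTo : ∀ {n} → Graph n → (ℕ → ℕ → Bool) → Set
IsoTo {n} G H = Σ (Fin n ↔ Fin n) λ f →
  ∀ u v → adj G u v ≡ H (toℕ (Inverse.to f u)) (toℕ (Inverse.to f v))

{-# OPTIONS --safe #-}

-- Put k = n − g. Choosing for every vertex off the cycle C a neighbour closer to C (its parent), every
-- edge is either an edge of C or joins a vertex off C to its parent: any other edge would lie on a second
-- cycle. With ch u the number of children of u, deg u ≤ 2 + ch u, and the ch u sum to k. Hence the degrees
-- at a tree edge sum to at most k + 3, so that it contributes at most √((k+2)²+1). For a cycle edge, convexity
-- of the Euclidean norm (chord) bounds √((2+x)²+(2+y)²), where x + y ≤ k, by the combination of
-- A = √((k+2)²+4) and B = √8 with weights (x+y)/k and 1 − (x+y)/k; summing over C gives at most 2A + (g−2)B.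
-- If no vertex has degree k + 2, the same argument with the smaller bound √((k+1)²+4) for tree edges makes
-- the inequality strict. A vertex of degree k + 2 lies on C and is adjacent to everything off C, and then
-- all these estimates are attained.
module Submission where

open import Defs renaming (sym to adj-sym)
open import Data.Bool as Bool using (Bool; true; false; if_then_else_; _∧_)
import Data.Bool.Properties as Boolₚ
open import Data.Empty using (⊥; ⊥-elim)
open import Data.Fin using (Fin; toℕ; fromℕ<)
import Data.Fin.Properties as Finₚ
open import Data.Integer as ℤ using (+_)
import Data.Integer.Properties as ℤₚ
open import Data.List using (List; []; _∷_; [_]; _++_; length; map; zip; filter; allFin; concatMap; cartesianProduct)
open import Data.List.Membership.Propositional using (_∈_; _∉_; find; lose)
import Data.List.Membership.Propositional.Properties as ∈ₚ
import Data.List.Properties as Listₚ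
open import Data.List.Relation.Binary.Permutation.Propositional as Perm using (_↭_; ↭-refl; ↭-trans; prep)
import Data.List.Relation.Binary.Permutation.Propositional.Properties as Permₚ
open import Data.List.Relation.Binary.Pointwise as Pointwise using (Pointwise; []; _∷_)
open import Data.List.Relation.Unary.All as All using (All; []; _∷_)
import Data.List.Relation.Unary.All.Properties as Allₚ
open import Data.List.Relation.Unary.AllPairs as AllPairs using (AllPairs; []; _∷_)
import Data.List.Relation.Unary.AllPairs.Properties as AllPairsₚ
open import Data.List.Relation.Unary.Any as Any using (Any; here; there)
open import Data.List.Relation.Unary.Unique.Propositional using (Unique)
import Data.List.Relation.Unary.Unique.Propositional.Properties as Uniqueₚ
open import Data.Nat as ℕ using (ℕ; zero; suc; _+_; _*_; _∸_; _≤_; _<_; z≤n; s≤s)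
open import Data.Nat.ListAction using (sum)
import Data.Nat.Properties as ℕₚ
open import Data.Nat.Tactic.RingSolver using (solve-∀)
open import Data.Product using (Σ; _×_; _,_; ∃; ∃₂; proj₁; proj₂; uncurry)
import Data.Product.Properties as Productₚ
open import Data.Rational as ℚ using (ℚ; 0ℚ; 1ℚ)
import Data.Rational.Properties as ℚₚ
import Data.Rational.Solver as ℚSolver
import Data.Rational.Unnormalised as ℚᵘ
import Data.Rational.Unnormalised.Properties as ℚᵘₚ
open import Data.Sum as Sum using (_⊎_; inj₁; inj₂)
import Data.Sum.Properties as Sumₚ
open import Function using (_∘_)
open import Function.Bundles using (_⇔_; Inverse; mk⇔; mk↔ₛ′)
open import Level using (0ℓ)
open import Relation.Binary using (Rel; DecidableEquality; tri<; tri≈; tri>)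
open import Relation.Binary.Construct.Closure.ReflexiveTransitive as Star using (Star; ε; _◅_; _◅◅_)
open import Relation.Binary.PropositionalEquality hiding ([_])
open import Relation.Nullary using (Dec; does; yes; no; ¬_; contradiction)
open import Relation.Nullary.Decidable using (¬?; _⊎-dec_; _×-dec_; dec-true)
open import Relation.Unary using (Decidable)

-- Rational approximations of square roots

-- No real number occurs. `≤√` quantifies over all rational lower bounds on the left and all upper
-- bounds on the right, so each estimate is made for arbitrary such rationals by comparing squares,
-- and the weights `(x+y)/k` are cleared by multiplying with `k`. The bounds arrive one per edge, in
-- the order in which `SO` lists the edges, while the estimate is organised by cycle pairs and
-- parent links. The two lists are never shown to be permutations of each other: an injective
-- matching suffices, because unmatched terms on the larger side are nonnegative. For the upper
-- bound every edge gets its own label; for sharpness every label gets its own edge. Strictness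
-- cannot be read off from arbitrary bounds; it comes from feeding `≤√` concrete approximations with
-- denominator `N`, whose total error in units of `1/N` does not depend on `N`.

≤-by : ∀ {m n} d → m + d ≡ n → m ≤ n
≤-by {m} d m+d≡n = subst (m ≤_) m+d≡n (ℕₚ.m≤m+n m d)

abstract
  -- Kept abstract because ℚ[ n ] unfolds to a normalised fraction, which blocks unification.
  ι : ℕ → ℚ
  ι = ℚ[_]

  ι≡ : ∀ n → ι n ≡ ℚ[ n ]
  ι≡ n = refl

  ι-+ : ∀ m n → ι (m + n) ≡ ι m ℚ.+ ι n
  ι-+ m n = ℚₚ.toℚᵘ-injective (ℚᵘₚ.≃-trans (ℚₚ.toℚᵘ-fromℚᵘ (ℚᵘ.mkℚᵘ (+ (m + n)) 0))
    (ℚᵘₚ.≃-trans (ℚᵘ.*≡* (cong (ℤ._* + 1) (cong₂ ℤ._+_ (sym (ℤₚ.*-identityʳ (+ m))) (sym (ℤₚ.*-identityʳ (+ n))))))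
    (ℚᵘₚ.≃-sym (ℚᵘₚ.≃-trans (ℚₚ.toℚᵘ-homo-+ (ι m) (ι n))
      (ℚᵘₚ.+-cong (ℚₚ.toℚᵘ-fromℚᵘ (ℚᵘ.mkℚᵘ (+ m) 0)) (ℚₚ.toℚᵘ-fromℚᵘ (ℚᵘ.mkℚᵘ (+ n) 0)))))))

  ι-* : ∀ m n → ι (m * n) ≡ ι m ℚ.* ι n
  ι-* m n = ℚₚ.toℚᵘ-injective (ℚᵘₚ.≃-trans (ℚₚ.toℚᵘ-fromℚᵘ (ℚᵘ.mkℚᵘ (+ (m * n)) 0))
    (ℚᵘₚ.≃-trans (ℚᵘ.*≡* (cong (ℤ._* + 1) (ℤₚ.pos-* m n)))
    (ℚᵘₚ.≃-sym (ℚᵘₚ.≃-trans (ℚₚ.toℚᵘ-homo-* (ι m) (ι n))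
      (ℚᵘₚ.*-cong (ℚₚ.toℚᵘ-fromℚᵘ (ℚᵘ.mkℚᵘ (+ m) 0)) (ℚₚ.toℚᵘ-fromℚᵘ (ℚᵘ.mkℚᵘ (+ n) 0)))))))

  1/n*n≡1 : ∀ m → (+ 1 ℚ./ suc m) ℚ.* ι (suc m) ≡ 1ℚ
  1/n*n≡1 m = ℚₚ.toℚᵘ-injective (ℚᵘₚ.≃-trans (ℚₚ.toℚᵘ-homo-* (+ 1 ℚ./ suc m) (ι (suc m)))
    (ℚᵘₚ.≃-trans (ℚᵘₚ.*-cong (ℚₚ.toℚᵘ-fromℚᵘ (ℚᵘ.mkℚᵘ (+ 1) m)) (ℚₚ.toℚᵘ-fromℚᵘ (ℚᵘ.mkℚᵘ (+ suc m) 0)))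
    (ℚᵘ.*≡* (ℤₚ.*-assoc (+ 1) (+ suc m) (+ 1)))))

  ι0 : ι 0 ≡ 0ℚ
  ι0 = refl

  ι1 : ι 1 ≡ 1ℚ
  ι1 = refl

  0≤ι : ∀ n → 0ℚ ℚ.≤ ι n
  0≤ι n = ℚₚ.nonNegative⁻¹ (ι n) {{ℚₚ.normalize-nonNeg n 1}}

0≤+ : ∀ {p q} → 0ℚ ℚ.≤ p → 0ℚ ℚ.≤ q → 0ℚ ℚ.≤ p ℚ.+ q
0≤+ = ℚₚ.+-mono-≤

0≤* : ∀ {p q} → 0ℚ ℚ.≤ p → 0ℚ ℚ.≤ q → 0ℚ ℚ.≤ p ℚ.* q
0≤* {p} {q} 0≤p 0≤q =
  ℚₚ.nonNegative⁻¹ _ {{ℚₚ.nonNeg*nonNeg⇒nonNeg p {{ℚ.nonNegative 0≤p}} q {{ℚ.nonNegative 0≤q}}}}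

*-monoʳ : ∀ {r p q} → 0ℚ ℚ.≤ r → p ℚ.≤ q → r ℚ.* p ℚ.≤ r ℚ.* q
*-monoʳ {r} 0≤r = ℚₚ.*-monoˡ-≤-nonNeg r {{ℚ.nonNegative 0≤r}}

*-mono : ∀ {p q r s} → 0ℚ ℚ.≤ p → 0ℚ ℚ.≤ s → p ℚ.≤ q → r ℚ.≤ s → p ℚ.* r ℚ.≤ q ℚ.* s
*-mono {p} {q} {r} {s} 0≤p 0≤s p≤q r≤s =
  ℚₚ.≤-trans (*-monoʳ 0≤p r≤s) (ℚₚ.*-monoʳ-≤-nonNeg s {{ℚ.nonNegative 0≤s}} p≤q)

ι-mono : ∀ {m n} → m ≤ n → ι m ℚ.≤ ι n
ι-mono {m} {n} m≤n = subst₂ ℚ._≤_ (ℚₚ.+-identityʳ (ι m))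
  (trans (sym (ι-+ m (n ∸ m))) (cong ι (ℕₚ.m+[n∸m]≡n m≤n)))
  (ℚₚ.+-monoʳ-≤ (ι m) (0≤ι (n ∸ m)))

ι-cancel : ∀ {m n} → ι m ℚ.≤ ι n → m ≤ n
ι-cancel {m} {n} ιm≤ιn with m ℕ.≤? n
... | yes m≤n = m≤n
... | no m≰n = contradiction (ℚₚ.<-≤-trans ιn<ι1+n (ℚₚ.≤-trans (ι-mono (ℕₚ.≰⇒> m≰n)) ιm≤ιn))
                             (ℚₚ.<-irrefl refl)
  where
  ιn<ι1+n : ι n ℚ.< ι (suc n)
  ιn<ι1+n = subst₂ ℚ._<_ (ℚₚ.+-identityˡ (ι n)) (sym (trans (ι-+ 1 n) (cong (ℚ._+ ι n) ι1)))
    (ℚₚ.+-monoˡ-< (ι n) (ℚₚ.positive⁻¹ 1ℚ))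

square-cancel-≤ : ∀ {p q} → 0ℚ ℚ.≤ q → p ℚ.* p ℚ.≤ q ℚ.* q → p ℚ.≤ q
square-cancel-≤ {p} {q} 0≤q p²≤q² with p ℚ.≤? q
... | yes p≤q = p≤q
... | no p≰q = contradiction
    (ℚₚ.<-≤-trans (ℚₚ.≤-<-trans (*-monoʳ 0≤q (ℚₚ.<⇒≤ q<p)) (ℚₚ.*-monoˡ-<-pos p {{ℚ.positive 0<p}} q<p)) p²≤q²)
    (ℚₚ.<-irrefl refl)
  where
  q<p = ℚₚ.≰⇒> p≰q
  0<p = ℚₚ.≤-<-trans 0≤q q<p

Lower Upper : ℕ → ℚ → Set
Lower r p = p ℚ.≤ 0ℚ ⊎ p ℚ.* p ℚ.≤ ι r
Upper r q = 0ℚ ℚ.≤ q × ι r ℚ.≤ q ℚ.* q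

toLower : ∀ {r p} → LowerBound r p → Lower r p
toLower {r} {p} = subst (λ i → p ℚ.≤ 0ℚ ⊎ p ℚ.* p ℚ.≤ i) (sym (ι≡ r))

fromLower : ∀ {r p} → Lower r p → LowerBound r p
fromLower {r} {p} = subst (λ i → p ℚ.≤ 0ℚ ⊎ p ℚ.* p ℚ.≤ i) (ι≡ r)

toUpper : ∀ {r q} → UpperBound r q → Upper r q
toUpper {r} {q} = subst (λ i → 0ℚ ℚ.≤ q × i ℚ.≤ q ℚ.* q) (sym (ι≡ r))

fromUpper : ∀ {r q} → Upper r q → UpperBound r q
fromUpper {r} {q} = subst (λ i → 0ℚ ℚ.≤ q × i ℚ.≤ q ℚ.* q) (ι≡ r)

lower-mono : ∀ {r s p} → r ≤ s → Lower r p → Lower s p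
lower-mono r≤s (inj₁ p≤0)  = inj₁ p≤0
lower-mono r≤s (inj₂ p²≤r) = inj₂ (ℚₚ.≤-trans p²≤r (ι-mono r≤s))

upper-mono : ∀ {r s q} → r ≤ s → Upper s q → Upper r q
upper-mono r≤s (0≤q , s≤q²) = 0≤q , ℚₚ.≤-trans (ι-mono r≤s) s≤q²

lower≤upper : ∀ {r p q} → Lower r p → Upper r q → p ℚ.≤ q
lower≤upper (inj₁ p≤0)  (0≤q , _)    = ℚₚ.≤-trans p≤0 0≤q
lower≤upper (inj₂ p²≤r) (0≤q , r≤q²) = square-cancel-≤ 0≤q (ℚₚ.≤-trans p²≤r r≤q²)

square-scale : ∀ t q → ι (t * t) ℚ.* (q ℚ.* q) ≡ (ι t ℚ.* q) ℚ.* (ι t ℚ.* q)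
square-scale t q rewrite ι-* t t =
  solve 2 (λ t q → (t :* t) :* (q :* q) := (t :* q) :* (t :* q)) refl (ι t) q
  where open ℚSolver.+-*-Solver

lower-scale : ∀ t {r p} → Lower r p → Lower (t * t * r) (ι t ℚ.* p)
lower-scale t (inj₁ p≤0) = inj₁ (ℚₚ.≤-trans (*-monoʳ (0≤ι t) p≤0) (ℚₚ.≤-reflexive (ℚₚ.*-zeroʳ (ι t))))
lower-scale t {r} {p} (inj₂ p²≤r) = inj₂ (subst₂ ℚ._≤_ (square-scale t p) (sym (ι-* (t * t) r))
  (*-monoʳ (0≤ι (t * t)) p²≤r))

upper-scale : ∀ t {r q} → Upper r q → Upper (t * t * r) (ι t ℚ.* q)
upper-scale t {r} {q} (0≤q , r≤q²) = 0≤* (0≤ι t) 0≤q ,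
  subst₂ ℚ._≤_ (sym (ι-* (t * t) r)) (square-scale t q) (*-monoʳ (0≤ι (t * t)) r≤q²)

-- `√r + √s` has square `r + 2√(rs) + s`, and `D` is a natural number below `√(rs)`. In `chord` it
-- is an inner product, so the hypothesis becomes an instance of Cauchy-Schwarz.
upper-+ : ∀ {r s q q′} D → D * D ≤ r * s → Upper r q → Upper s q′ →
          Upper (r + 2 * D + s) (q ℚ.+ q′)
upper-+ {r} {s} {q} {q′} D D²≤rs (0≤q , r≤q²) (0≤q′ , s≤q′²) = 0≤+ 0≤q 0≤q′ ,
  subst₂ ℚ._≤_ (sym eq₁) eq₂ (ℚₚ.+-mono-≤ (ℚₚ.+-mono-≤ r≤q² (*-monoʳ 0≤2 D≤qq′)) s≤q′²)
  where
  open ℚSolver.+-*-Solver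
  eq₁ : ι (r + 2 * D + s) ≡ ι r ℚ.+ (1ℚ ℚ.+ 1ℚ) ℚ.* ι D ℚ.+ ι s
  eq₁ = trans (ι-+ (r + 2 * D) s) (cong (ℚ._+ ι s) (trans (ι-+ r (2 * D)) (cong (ι r ℚ.+_) (trans (ι-* 2 D) (cong (ℚ._* ι D) (trans (ι-+ 1 1) (cong₂ ℚ._+_ ι1 ι1)))))))
  eq₂ : q ℚ.* q ℚ.+ (1ℚ ℚ.+ 1ℚ) ℚ.* (q ℚ.* q′) ℚ.+ q′ ℚ.* q′ ≡ (q ℚ.+ q′) ℚ.* (q ℚ.+ q′)
  eq₂ = solve 2 (λ q q′ → q :* q :+ (con 1ℚ :+ con 1ℚ) :* (q :* q′) :+ q′ :* q′ := (q :+ q′) :* (q :+ q′)) refl q q′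
  0≤2 : 0ℚ ℚ.≤ 1ℚ ℚ.+ 1ℚ
  0≤2 = 0≤+ (ℚₚ.<⇒≤ (ℚₚ.positive⁻¹ 1ℚ)) (ℚₚ.<⇒≤ (ℚₚ.positive⁻¹ 1ℚ))
  D≤qq′ : ι D ℚ.≤ q ℚ.* q′
  D≤qq′ = square-cancel-≤ (0≤* 0≤q 0≤q′) (begin
    ι D ℚ.* ι D                 ≡⟨ ι-* D D ⟨
    ι (D * D)                   ≤⟨ ι-mono D²≤rs ⟩
    ι (r * s)                   ≡⟨ ι-* r s ⟩
    ι r ℚ.* ι s                 ≤⟨ *-mono (0≤ι r) (0≤* 0≤q′ 0≤q′) r≤q² s≤q′² ⟩
    q ℚ.* q ℚ.* (q′ ℚ.* q′)     ≡⟨ solve 2 (λ q q′ → q :* q :* (q′ :* q′) := q :* q′ :* (q :* q′)) refl q q′ ⟩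
    q ℚ.* q′ ℚ.* (q ℚ.* q′)     ∎)
    where open ℚₚ.≤-Reasoning

-- Minkowski: k (2 + x , 2 + y) = x (2 + k , 2) + y (2 , 2 + k) + z (2 , 2) for k = x + y + z.
chord : ∀ x y z {p a b} → let k = x + y + z in
        Lower ((2 + x) * (2 + x) + (2 + y) * (2 + y)) p →
        Upper ((k + 2) * (k + 2) + 4) a → Upper 8 b →
        ι k ℚ.* p ℚ.≤ ι (x + y) ℚ.* a ℚ.+ ι z ℚ.* b
chord x y z lb ua ub = lower≤upper (lower-mono (norms x y z) (lower-scale k lb))
  (upper-+ D D²≤ (upper-scale (x + y) ua) (upper-scale z ub))
  where
  k = x + y + z
  -- The inner product of `x (2 + k , 2) + y (2 , 2 + k)` with `z (2 , 2)`.
  D = (x + y) * z * (2 * k + 8)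
  D²≤ : D * D ≤ (x + y) * (x + y) * ((k + 2) * (k + 2) + 4) * (z * z * 8)
  D²≤ = ≤-by _ (eq (x + y) z k)
    where
    eq : ∀ t z k → t * z * (2 * k + 8) * (t * z * (2 * k + 8)) + 4 * (t * z * k * (t * z * k))
                 ≡ t * t * ((k + 2) * (k + 2) + 4) * (z * z * 8)
    eq = solve-∀
  norms : ∀ x y z → let k = x + y + z in
    k * k * ((2 + x) * (2 + x) + (2 + y) * (2 + y)) ≤
    (x + y) * (x + y) * ((k + 2) * (k + 2) + 4) + 2 * ((x + y) * z * (2 * k + 8)) + z * z * 8
  -- In squares, `2xyk²` is what is lost when the norm of `x (2 + k , 2) + y (2 , 2 + k)` is
  -- replaced by `x + y` times the common norm of the two vectors.
  norms x y z = ≤-by (2 * x * y * ((x + y + z) * (x + y + z))) (eq x y z)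
    where
    eq : ∀ x y z → let k = x + y + z in
      k * k * ((2 + x) * (2 + x) + (2 + y) * (2 + y)) + 2 * x * y * (k * k) ≡
      (x + y) * (x + y) * ((k + 2) * (k + 2) + 4) + 2 * ((x + y) * z * (2 * k + 8)) + z * z * 8
    eq = solve-∀

-- Integer square roots and strict comparison

isqrt : ∀ m → ∃ λ s → s * s ≤ m × m < suc s * suc s
isqrt zero = 0 , z≤n , s≤s z≤n
isqrt (suc m) with isqrt m
... | s , s²≤m , m<s′² with suc s * suc s ℕ.≤? suc m
...   | yes s′²≤ = suc s , s′²≤ , ℕₚ.<-≤-trans (s≤s m<s′²)
                     (≤-by (2 * s + 2) (eq s))
  where
  eq : ∀ s → suc (suc s * suc s) + (2 * s + 2) ≡ suc (suc s) * suc (suc s)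
  eq = solve-∀
...   | no  s′²≰ = s , ℕₚ.m≤n⇒m≤1+n s²≤m , ℕₚ.≰⇒> s′²≰

⌊√_⌋ : ℕ → ℕ
⌊√ m ⌋ = proj₁ (isqrt m)

module _ (N-1 : ℕ) where
  private
    N = suc N-1
    1/N : ℚ
    1/N = + 1 ℚ./ N

  0≤1/N : 0ℚ ℚ.≤ 1/N
  0≤1/N = ℚₚ.nonNegative⁻¹ 1/N {{ℚₚ.normalize-nonNeg 1 N}}

  unscale : ∀ r → 1/N ℚ.* 1/N ℚ.* ι (r * (N * N)) ≡ ι r
  unscale r = begin
    1/N ℚ.* 1/N ℚ.* ι (r * (N * N))          ≡⟨ cong (1/N ℚ.* 1/N ℚ.*_) (trans (ι-* r (N * N)) (cong (ι r ℚ.*_) (ι-* N N))) ⟩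
    1/N ℚ.* 1/N ℚ.* (ι r ℚ.* (ι N ℚ.* ι N))  ≡⟨ solve 3 (λ e r n → e :* e :* (r :* (n :* n)) := r :* ((e :* n) :* (e :* n))) refl 1/N (ι r) (ι N) ⟩
    ι r ℚ.* ((1/N ℚ.* ι N) ℚ.* (1/N ℚ.* ι N)) ≡⟨ cong (λ e → ι r ℚ.* (e ℚ.* e)) (1/n*n≡1 N-1) ⟩
    ι r ℚ.* 1ℚ                               ≡⟨ ℚₚ.*-identityʳ (ι r) ⟩
    ι r                                      ∎
    where open ≡-Reasoning
          open ℚSolver.+-*-Solver

  square-1/N : ∀ s → 1/N ℚ.* 1/N ℚ.* ι (s * s) ≡ (1/N ℚ.* ι s) ℚ.* (1/N ℚ.* ι s)
  square-1/N s rewrite ι-* s s =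
    solve 2 (λ e s → e :* e :* (s :* s) := (e :* s) :* (e :* s)) refl 1/N (ι s)
    where open ℚSolver.+-*-Solver

  lowerApprox : ∀ r → Lower r (1/N ℚ.* ι ⌊√ r * (N * N) ⌋)
  lowerApprox r = inj₂ (subst₂ ℚ._≤_ (square-1/N _) (unscale r)
    (*-monoʳ (0≤* 0≤1/N 0≤1/N) (ι-mono (proj₁ (proj₂ (isqrt (r * (N * N))))))))

  upperApprox : ∀ r → Upper r (1/N ℚ.* ι (suc ⌊√ r * (N * N) ⌋))
  upperApprox r = 0≤* 0≤1/N (0≤ι _) , subst₂ ℚ._≤_ (unscale r) (square-1/N _)
    (*-monoʳ (0≤* 0≤1/N 0≤1/N) (ι-mono (ℕₚ.<⇒≤ (proj₂ (proj₂ (isqrt (r * (N * N))))))))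

  approx : SqrtSum → ℕ
  approx xs = sum (map (λ t → proj₁ t * ⌊√ proj₂ t * (N * N) ⌋) xs)

  lowers : ∀ xs → Lowers xs
  lowers []             = []
  lowers ((c , r) ∷ xs) = (_ , fromLower (lowerApprox r)) ∷ lowers xs

  uppers : ∀ xs → Uppers xs
  uppers []             = []
  uppers ((c , r) ∷ xs) = (_ , fromUpper (upperApprox r)) ∷ uppers xs

  factor-1/N : ∀ c s t → ι c ℚ.* (1/N ℚ.* ι s) ℚ.+ 1/N ℚ.* ι t ≡ 1/N ℚ.* ι (c * s + t)
  factor-1/N c s t rewrite ι-+ (c * s) t | ι-* c s =
    solve 4 (λ e c s t → c :* (e :* s) :+ e :* t := e :* (c :* s :+ t)) refl 1/N (ι c) (ι s) (ι t)
    where open ℚSolver.+-*-Solver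

  eval-lowers : ∀ xs → evalApprox (lowers xs) ≡ 1/N ℚ.* ι (approx xs)
  eval-lowers [] = sym (trans (cong (1/N ℚ.*_) ι0) (ℚₚ.*-zeroʳ 1/N))
  eval-lowers ((c , r) ∷ xs) rewrite eval-lowers xs | sym (ι≡ c) = factor-1/N c _ _

  eval-uppers : ∀ xs → evalApprox (uppers xs) ≡ 1/N ℚ.* ι (approx xs + sum (map proj₁ xs))
  eval-uppers [] = sym (trans (cong (1/N ℚ.*_) ι0) (ℚₚ.*-zeroʳ 1/N))
  eval-uppers ((c , r) ∷ xs) rewrite eval-uppers xs | sym (ι≡ c) =
    trans (factor-1/N c (suc s) (approx xs + sum (map proj₁ xs)))
          (cong (λ m → 1/N ℚ.* ι m) (eq c s (approx xs) (sum (map proj₁ xs))))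
    where
    s = ⌊√ r * (N * N) ⌋
    eq : ∀ c s t u → c * suc s + (t + u) ≡ c * s + t + (c + u)
    eq = solve-∀

  -- Each upper approximation exceeds the lower one by `1/N`, so clearing the denominator leaves an
  -- error equal to the sum of the coefficients of `ys`, whatever `N` is.
  ≤√⇒approx≤ : ∀ xs ys → xs ≤√ ys → approx xs ≤ approx ys + sum (map proj₁ ys)
  ≤√⇒approx≤ xs ys xs≤ys = ι-cancel (ℚₚ.*-cancelˡ-≤-pos 1/N {{ℚₚ.normalize-pos 1 N}}
    (subst₂ ℚ._≤_ (eval-lowers xs) (eval-uppers ys) (xs≤ys (lowers xs) (uppers ys))))

-- `√(R+1) - √R` is a fixed positive number, so scaling by a large `N` makes the gap exceed any `M`.
√-gap : ∀ R M → ∃ λ N-1 → let N = suc N-1 in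
        ⌊√ R * (N * N) ⌋ + suc M ≤ ⌊√ suc R * (N * N) ⌋
√-gap R M = N-1 , ≤-from-squares
  where
  -- With `t = M + 1` and the crude bound `s ≤ N (R+1)`, the cross term `2st` is at most
  -- `(2R+2)(2R+3) t²`. Since `N² = (2R+3)² t²`, there remains `(2R+3) t²`, which absorbs `t²`.
  N = suc M * (2 * R + 3)
  N-1 = (2 * R + 2) + M * (2 * R + 3)
  s = ⌊√ R * (suc N-1 * suc N-1) ⌋
  s′ = ⌊√ suc R * (suc N-1 * suc N-1) ⌋
  N≡ : suc N-1 ≡ N
  N≡ = eq R M
    where
    eq : ∀ R M → suc ((2 * R + 2) + M * (2 * R + 3)) ≡ suc M * (2 * R + 3)
    eq = solve-∀
  s²≤ : s * s ≤ R * (N * N)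
  s²≤ = subst (λ n → s * s ≤ R * (n * n)) N≡ (proj₁ (proj₂ (isqrt (R * (suc N-1 * suc N-1)))))
  <s′² : suc R * (N * N) < suc s′ * suc s′
  <s′² = subst (λ n → suc R * (n * n) < suc s′ * suc s′) N≡ (proj₂ (proj₂ (isqrt (suc R * (suc N-1 * suc N-1)))))
  square-cancel-<ℕ : ∀ {m n} → m * m < n * n → m < n
  square-cancel-<ℕ {m} {n} m²<n² with n ℕ.≤? m
  ... | yes n≤m = contradiction (ℕₚ.*-mono-≤ n≤m n≤m) (ℕₚ.<⇒≱ m²<n²)
  ... | no n≰m = ℕₚ.≰⇒> n≰m
  s≤ : s ≤ N * suc R
  s≤ = ℕₚ.≮⇒≥ λ NR<s → contradiction
    (ℕₚ.≤-trans (ℕₚ.*-mono-≤ NR<s NR<s) s²≤)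
    (ℕₚ.<⇒≱ (≤-by _ (eq R N)))
    where
    eq : ∀ R N → suc (R * (N * N)) + (R * R * (N * N) + R * (N * N) + N * N + 2 * (N * suc R))
               ≡ suc (N * suc R) * suc (N * suc R)
    eq = solve-∀
  ≤-from-squares : s + suc M ≤ s′
  ≤-from-squares = ℕₚ.≤-pred (square-cancel-<ℕ (ℕₚ.≤-<-trans (begin
    (s + suc M) * (s + suc M)                    ≡⟨ expand s (suc M) ⟩
    s * s + (2 * s * suc M + suc M * suc M)      ≤⟨ ℕₚ.+-mono-≤ s²≤ (ℕₚ.+-monoˡ-≤ (suc M * suc M) (ℕₚ.*-monoˡ-≤ (suc M) (ℕₚ.*-monoʳ-≤ 2 s≤))) ⟩
    R * (N * N) + (2 * (N * suc R) * suc M + suc M * suc M) ≤⟨ ℕₚ.+-monoʳ-≤ (R * (N * N)) (ℕₚ.m≤m+n _ (suc M * suc M * (2 * R + 2))) ⟩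
    R * (N * N) + (2 * (N * suc R) * suc M + suc M * suc M + suc M * suc M * (2 * R + 2)) ≡⟨ eq R (suc M) ⟩
    suc R * (N * N) ∎) <s′²))
    where
    open ℕₚ.≤-Reasoning
    expand : ∀ s t → (s + t) * (s + t) ≡ s * s + (2 * s * t + t * t)
    expand = solve-∀
    eq : ∀ R t → let N = t * (2 * R + 3) in
      R * (N * N) + (2 * (N * suc R) * t + t * t + t * t * (2 * R + 2)) ≡ suc R * (N * N)
    eq = solve-∀

⌊√⌋-mono : ∀ {m n} → m ≤ n → ⌊√ m ⌋ ≤ ⌊√ n ⌋
⌊√⌋-mono {m} {n} m≤n with isqrt m | isqrt n
... | s , s²≤m , _ | t , _ , n<t′² = ℕₚ.≮⇒≥ λ t<s →
  contradiction (ℕₚ.≤-trans (ℕₚ.*-mono-≤ t<s t<s) (ℕₚ.≤-trans s²≤m m≤n)) (ℕₚ.<⇒≱ n<t′²)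


-- Comparing 1/N-approximations on both sides of ys would squeeze a gap that grows with N into a fixed error.
≤√-strict : ∀ {A B R R′ a b k} ys → 1 ≤ k → R < R′ →
  ((a , A) ∷ (k , R′) ∷ (b , B) ∷ []) ≤√ ys →
  ¬ (ys ≤√ ((a , A) ∷ (k , R) ∷ (b , B) ∷ []))
≤√-strict {A} {B} {R} {R′} {a} {b} {suc k} ys _ R<R′ xs′≤ys ys≤xs = ℕₚ.<-irrefl refl (begin-strict
  α + (suc k * s + (β + 0)) + M              <⟨ ℕₚ.≤-refl ⟩
  suc (α + (suc k * s + (β + 0)) + M)        ≡⟨ eq₁ α (k * s) s β M ⟩
  α + (s + suc M + k * s + (β + 0))          ≤⟨ ℕₚ.+-monoʳ-≤ α (ℕₚ.+-monoˡ-≤ (β + 0) (ℕₚ.+-mono-≤ s+M≤s′ (ℕₚ.*-monoʳ-≤ k s≤s′))) ⟩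
  approx N-1 xs′                             ≤⟨ ≤√⇒approx≤ N-1 xs′ ys xs′≤ys ⟩
  approx N-1 ys + sum (map proj₁ ys)         ≤⟨ ℕₚ.+-monoˡ-≤ _ (≤√⇒approx≤ N-1 ys xs ys≤xs) ⟩
  approx N-1 xs + sum (map proj₁ xs) + sum (map proj₁ ys) ≡⟨ ℕₚ.+-assoc (approx N-1 xs) _ _ ⟩
  approx N-1 xs + M                          ∎)
  where
  open ℕₚ.≤-Reasoning
  xs xs′ : SqrtSum
  xs = (a , A) ∷ (suc k , R) ∷ (b , B) ∷ []
  xs′ = (a , A) ∷ (suc k , R′) ∷ (b , B) ∷ []
  -- The rounding errors of both comparisons together. They involve coefficients only, so `N` can be
  -- chosen after `M`.
  M = sum (map proj₁ xs) + sum (map proj₁ ys)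
  N-1 = proj₁ (√-gap R M)
  α = a * ⌊√ A * (suc N-1 * suc N-1) ⌋
  β = b * ⌊√ B * (suc N-1 * suc N-1) ⌋
  s = ⌊√ R * (suc N-1 * suc N-1) ⌋
  s′ = ⌊√ R′ * (suc N-1 * suc N-1) ⌋
  s+M≤s′ : s + suc M ≤ s′
  s+M≤s′ = ℕₚ.≤-trans (proj₂ (√-gap R M)) (⌊√⌋-mono (ℕₚ.*-monoˡ-≤ (suc N-1 * suc N-1) R<R′))
  s≤s′ : s ≤ s′
  s≤s′ = ℕₚ.≤-trans (ℕₚ.m≤m+n s (suc M)) s+M≤s′
  eq₁ : ∀ α x s β M → suc (α + (s + x + (β + 0)) + M) ≡ α + (s + suc M + x + (β + 0))
  eq₁ = solve-∀

-- Matchings, paths and parents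

module _ {A B : Set} (R : A → B → Set) where

  -- Greedy choice: once an `x` has taken its `y`, that `y` can be deleted, because by exclusiveness
  -- no later element is related to it.
  matching : ∀ {xs} ys → AllPairs (λ x x′ → ∀ y → R x y → ¬ R x′ y) xs →
             All (λ x → Any (R x) ys) xs →
             ∃₂ λ ws zs → Pointwise R xs ws × ys ↭ ws ++ zs
  matching ys [] [] = [] , ys , [] , ↭-refl
  matching ys (x# ∷ xs#) (x~ ∷ xs~) with find x~
  ... | y , y∈ys , Rxy with ∈ₚ.∈-∃++ y∈ys
  ... | ls , rs , refl with matching (ls ++ rs) xs# (All.zipWith avoid (x# , xs~))
    where
    avoid : ∀ {x′} → (∀ z → R _ z → ¬ R x′ z) × Any (R x′) (ls ++ y ∷ rs) → Any (R x′) (ls ++ rs)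
    avoid (# , x′~) with Permₚ.Any-resp-↭ (Permₚ.shift y ls rs) x′~
    ... | here Rx′y = contradiction Rx′y (# y Rxy)
    ... | there x′~′ = x′~′
  ... | ws , zs , xs~ws , ls++rs↭ = y ∷ ws , zs , Rxy ∷ xs~ws , ↭-trans (Permₚ.shift y ls rs) (prep y ls++rs↭)

unique-⊆⇒length≤ : ∀ {A : Set} {xs ys : List A} → Unique xs → (∀ {x} → x ∈ xs → x ∈ ys) → length xs ≤ length ys
unique-⊆⇒length≤ {xs = xs} {ys} xs! xs⊆ys
  with matching _≡_ ys (AllPairs.map (λ x≢x′ _ x≡y x′≡y → x≢x′ (trans x≡y (sym x′≡y))) xs!) (All.tabulate xs⊆ys)
... | ws , zs , xs≡ws , ys↭ = begin
  length xs         ≡⟨ Pointwise.Pointwise-length xs≡ws ⟩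
  length ws         ≤⟨ ℕₚ.m≤m+n (length ws) (length zs) ⟩
  length ws + length zs ≡⟨ Listₚ.length-++ ws ⟨
  length (ws ++ zs) ≡⟨ Permₚ.↭-length ys↭ ⟨
  length ys         ∎
  where open ℕₚ.≤-Reasoning

data Path {V : Set} (R : V → V → Set) : V → V → List V → Set where
  end : ∀ v → Path R v v (v ∷ [])
  _∷_ : ∀ {u w v xs} → R u w → Path R w v xs → Path R u v (u ∷ xs)

module _ {V : Set} {R : V → V → Set} where

  path-suffix : ∀ {u v w xs} → u ∈ xs → Path R w v xs → Unique xs →
                ∃ λ ys → Path R u v ys × Unique ys
  path-suffix (here refl) (end v)  xs!       = _ , end v , xs!
  path-suffix (here refl) (r ∷ p)  xs!       = _ , r ∷ p , xs!
  path-suffix (there u∈xs) (r ∷ p) (_ ∷ xs!) = path-suffix u∈xs p xs!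

  module _ (_≟_ : DecidableEquality V) where
    open import Data.List.Membership.DecPropositional _≟_ using (_∈?_)

    -- Loop erasure: if the new start already lies on the simple path, everything before that
    -- occurrence is cut off.
    simplePath : ∀ {u v} → Star R u v → ∃ λ xs → Path R u v xs × Unique xs
    simplePath ε = _ , end _ , [] ∷ []
    simplePath (_◅_ {i = u} r w) with simplePath w
    ... | xs , p , xs! with u ∈? xs
    ...   | yes u∈xs = path-suffix u∈xs p xs!
    ...   | no u∉xs  = u ∷ xs , r ∷ p , Allₚ.¬Any⇒All¬ xs u∉xs ∷ xs!

  -- When `z` is the first vertex `x`, the zipped list is `cyclePairs (x ∷ xs)`, so a path and a
  -- closing edge give the edge condition of `IsCycle`.
  path-pairs : ∀ {P : V → V → Set} {u v x xs z} → (∀ {a b} → R a b → P a b) → P v z →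
               Path R u v (x ∷ xs) → All (uncurry P) (zip (x ∷ xs) (xs ++ [ z ]))
  path-pairs f Pvz (end _)          = Pvz ∷ []
  path-pairs f Pvz (r ∷ end v)    = f r ∷ Pvz ∷ []
  path-pairs f Pvz (r ∷ (r′ ∷ p)) = f r ∷ path-pairs f Pvz (r′ ∷ p)

  path-last : ∀ {u v x xs z} → Path R u v (x ∷ xs) → (v , z) ∈ zip (x ∷ xs) (xs ++ [ z ])
  path-last (end _)          = here refl
  path-last (r ∷ end v)    = there (here refl)
  path-last (r ∷ (r′ ∷ p)) = there (path-last (r′ ∷ p))

zip-connected : ∀ {V : Set} (x : V) xs z {c} → c ∈ x ∷ xs →
                Star (λ a b → (a , b) ∈ zip (x ∷ xs) (xs ++ [ z ])) x c
zip-connected x xs       z (here refl) = ε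
zip-connected x (y ∷ xs) z (there c∈)  = here refl ◅ Star.map there (zip-connected y xs z c∈)

-- Cycle edges and tree edges of a unicyclic graph

module Structure {n} (G : Graph n) (connected : Connected G)
  (unique-cycle : ∀ vs ws → IsCycle G vs → IsCycle G ws → ∀ u v → CycleEdge vs u v → CycleEdge ws u v)
  (C : List (Fin n)) (C-cycle : IsCycle G C) where

  open import Data.List.Membership.DecPropositional (Finₚ._≟_ {n}) using (_∈?_)

  adj? : ∀ u v → Dec (Adj G u v)
  adj? u v = adj G u v Bool.≟ true

  Adj-sym : ∀ {u v} → Adj G u v → Adj G v u
  Adj-sym {u} {v} = trans (adj-sym G v u)

  Adj-irrefl : ∀ {v} → ¬ Adj G v v
  Adj-irrefl {v} vv with trans (sym vv) (irrefl G v)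
  ... | ()

  Avoiding : Fin n → Fin n → Rel (Fin n) 0ℓ
  Avoiding u v a b = Adj G a b × ¬ (a ≡ u × b ≡ v) × ¬ (a ≡ v × b ≡ u)

  Avoiding-sym : ∀ {u v a b} → Avoiding u v a b → Avoiding u v b a
  Avoiding-sym (ab , ≢uv , ≢vu) =
    Adj-sym ab , (λ { (b≡u , a≡v) → ≢vu (a≡v , b≡u) }) , (λ { (b≡v , a≡u) → ≢uv (a≡u , b≡v) })

  -- Made simple and closed by `uv`, the detour is a cycle through `uv`, and all cycles have the
  -- same edges. Paths with fewer than two edges are ruled out: they would make `uv` a loop or use
  -- the avoided edge.
  detour⇒cycleEdge : ∀ {u v} → Adj G u v → Star (Avoiding u v) v u → CycleEdge C u v
  detour⇒cycleEdge {u} {v} uv detour with simplePath Finₚ._≟_ detour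
  ... | _ , end _ , _ = contradiction uv Adj-irrefl
  ... | _ , (_ , _ , ≢vu) ∷ end _ , _ = contradiction (refl , refl) ≢vu
  ... | _ , r ∷ (r′ ∷ p) , xs! =
    unique-cycle _ C (xs! , s≤s (s≤s (nonempty p)) , path-pairs proj₁ uv path) C-cycle u v
      (inj₁ (path-last path))
    where
    path = r ∷ (r′ ∷ p)
    nonempty : ∀ {a b xs} → Path (Avoiding u v) a b xs → 1 ≤ length xs
    nonempty (end _)   = s≤s z≤n
    nonempty (_ ∷ _) = s≤s z≤n

  -- Distance to `C` at most `m`. The cumulative form makes it monotone in `m` and decidable by
  -- recursion; the distance itself is never computed.
  Within : ℕ → Fin n → Set
  Within zero    v = v ∈ C
  Within (suc m) v = Within m v ⊎ ∃ λ u → Adj G v u × Within m u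

  within? : ∀ m v → Dec (Within m v)
  within? zero    v = v ∈? C
  within? (suc m) v = within? m v ⊎-dec Finₚ.any? (λ u → adj? v u ×-dec within? m u)

  within-mono : ∀ {m m′ v} → m ℕ.≤′ m′ → Within m v → Within m′ v
  within-mono ℕ.≤′-refl       w = w
  within-mono (ℕ.≤′-step m≤m′) w = inj₁ (within-mono m≤m′ w)

  reachable⇒within : ∀ {v c} → Reachable G v c → c ∈ C → ∃ λ m → Within m v
  reachable⇒within here c∈C = 0 , c∈C
  reachable⇒within (step vu r) c∈C with reachable⇒within r c∈C
  ... | m , w = suc m , inj₂ (_ , vu , w)

  ∃∈C : ∃ (_∈ C)
  ∃∈C = head (proj₁ (proj₂ C-cycle))
    where
    head : ∀ {vs : List (Fin n)} → 3 ≤ length vs → ∃ (_∈ vs)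
    head {v ∷ _} _ = v , here refl

  within-some : ∀ v → ∃ λ m → Within m v
  within-some v = reachable⇒within (connected v (proj₁ ∃∈C)) (proj₂ ∃∈C)

  -- Quantifying over all `j` says that `u` is a step closer to `C` than `v` without naming a
  -- distance; `climb` recurses along exactly this implication.
  CloserNeighbour : Fin n → Fin n → Set
  CloserNeighbour v u = Adj G v u × ∀ j → Within (suc j) v → Within j u

  -- Lowering `m` until `Within m v` fails makes `suc m` the exact distance. The neighbour found
  -- there serves every `j`, since `Within (suc j) v` then forces `m ≤ j`.
  closer : ∀ m v → Within m v → v ∉ C → ∃ (CloserNeighbour v)
  closer zero    v v∈C v∉C = contradiction v∈C v∉C
  closer (suc m) v w   v∉C with within? m v
  ... | yes w′ = closer m v w′ v∉C
  ... | no ¬w′ with w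
  ...   | inj₁ w′ = contradiction w′ ¬w′
  ...   | inj₂ (u , vu , wu) = u , vu , λ j wj → within-mono (ℕₚ.≤⇒≤′ (ℕₚ.≮⇒≥ λ j<m →
            ¬w′ (within-mono (ℕₚ.≤⇒≤′ j<m) wj))) wu

  parent-spec : ∀ v → ∃ λ u → v ∉ C → CloserNeighbour v u
  parent-spec v with v ∈? C
  ... | yes v∈C = v , λ v∉C → contradiction v∈C v∉C
  ... | no v∉C with closer _ v (proj₂ (within-some v)) v∉C
  ...   | u , c = u , λ _ → c

  -- Only meaningful off the cycle.
  parent : Fin n → Fin n
  parent v = proj₁ (parent-spec v)

  parent-adj : ∀ {v} → v ∉ C → Adj G v (parent v)
  parent-adj v∉C = proj₁ (proj₂ (parent-spec _) v∉C)

  TreeEdge : Rel (Fin n) 0ℓ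
  TreeEdge v u = v ∉ C × parent v ≡ u

  climb : ∀ m v → Within m v → ∃ λ c → c ∈ C × Star TreeEdge v c
  climb zero    v v∈C = v , v∈C , ε
  climb (suc m) v w with v ∈? C
  ... | yes v∈C = v , v∈C , ε
  ... | no v∉C with climb m (parent v) (proj₂ (proj₂ (parent-spec v) v∉C) m w)
  ...   | c , c∈C , path = c , c∈C , (v∉C , refl) ◅ path

  C-connected : ∀ {a b} → a ∈ C → b ∈ C → Star (CycleEdge C) a b
  C-connected = lemma C
    where
    lemma : ∀ vs {a b} → a ∈ vs → b ∈ vs → Star (CycleEdge vs) a b
    lemma (x ∷ xs) a∈ b∈ = Star.reverse Sum.swap (Star.map inj₁ (zip-connected x xs x a∈))
                        ◅◅ Star.map inj₁ (zip-connected x xs x b∈)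

  cycleEdge-adj : ∀ {u v} → CycleEdge C u v → Adj G u v
  cycleEdge-adj (inj₁ uv∈) = All.lookup (proj₂ (proj₂ C-cycle)) uv∈
  cycleEdge-adj (inj₂ vu∈) = Adj-sym (All.lookup (proj₂ (proj₂ C-cycle)) vu∈)

  cycleEdge? : ∀ u v → Dec (CycleEdge C u v)
  cycleEdge? u v = (u , v) ∈×? cyclePairs C ⊎-dec (v , u) ∈×? cyclePairs C
    where open import Data.List.Membership.DecPropositional (Productₚ.≡-dec (Finₚ._≟_ {n}) (Finₚ._≟_ {n})) renaming (_∈?_ to _∈×?_)

  treeEdge? : ∀ u v → Dec (TreeEdge u v)
  treeEdge? u v = ¬? (u ∈? C) ×-dec parent u Finₚ.≟ v

  -- Otherwise climbing from both ends to the cycle would give a detour around uv.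
  edge-cases : ∀ {u v} → Adj G u v → CycleEdge C u v ⊎ TreeEdge u v ⊎ TreeEdge v u
  edge-cases {u} {v} uv with cycleEdge? u v | treeEdge? u v | treeEdge? v u
  ... | yes c | _ | _ = inj₁ c
  ... | no _ | yes t | _ = inj₂ (inj₁ t)
  ... | no _ | no _ | yes t = inj₂ (inj₂ t)
  ... | no ¬c | no ¬uv | no ¬vu = inj₁ (detour⇒cycleEdge uv
      (let cᵤ , cᵤ∈C , pathᵤ = climb _ u (proj₂ (within-some u))
           cᵥ , cᵥ∈C , pathᵥ = climb _ v (proj₂ (within-some v))
       in Star.map tree-avoids pathᵥ ◅◅ Star.map cycle-avoids (C-connected cᵥ∈C cᵤ∈C)
          ◅◅ Star.reverse Avoiding-sym (Star.map tree-avoids pathᵤ)))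
    where
    tree-avoids : ∀ {a b} → TreeEdge a b → Avoiding u v a b
    tree-avoids t@(a∉C , refl) = parent-adj a∉C ,
      (λ { (refl , refl) → ¬uv t }) , (λ { (refl , e) → ¬vu (a∉C , e) })
    cycle-avoids : ∀ {a b} → CycleEdge C a b → Avoiding u v a b
    cycle-avoids c = cycleEdge-adj c , (λ { (refl , refl) → ¬c c }) , (λ { (refl , refl) → ¬c (Sum.swap c) })

-- Positions in a cycle and sums over its edges

-- Positions are a relation rather than a lookup function, so that positions in `C` and in
-- `C ++ off` can be compared without casts between `Fin` types.
data At {A : Set} : List A → ℕ → A → Set where
  here  : ∀ {x xs} → At (x ∷ xs) 0 x
  there : ∀ {x y xs i} → At xs i y → At (x ∷ xs) (suc i) y

module _ {A : Set} where

  at-functional : ∀ {xs : List A} {i x y} → At xs i x → At xs i y → x ≡ y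
  at-functional here      here      = refl
  at-functional (there p) (there q) = at-functional p q

  at⇒∈ : ∀ {xs : List A} {i x} → At xs i x → x ∈ xs
  at⇒∈ here      = here refl
  at⇒∈ (there p) = there (at⇒∈ p)

  ∈⇒at : ∀ {xs : List A} {x} → x ∈ xs → ∃ λ i → At xs i x
  ∈⇒at (here refl) = 0 , here
  ∈⇒at (there x∈) with ∈⇒at x∈
  ... | i , p = suc i , there p

  at⇒< : ∀ {xs : List A} {i x} → At xs i x → i < length xs
  at⇒< here      = s≤s z≤n
  at⇒< (there p) = s≤s (at⇒< p)

  <⇒at : ∀ {xs : List A} {i} → i < length xs → ∃ (At xs i)
  <⇒at {x ∷ xs} {zero}  _         = x , here
  <⇒at {x ∷ xs} {suc i} (s≤s i<) with <⇒at i<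
  ... | y , p = y , there p

  at-injective : ∀ {xs : List A} {i j x} → Unique xs → At xs i x → At xs j x → i ≡ j
  at-injective _           here      here      = refl
  at-injective (x≢ ∷ _)    here      (there q) = contradiction refl (All.lookup x≢ (at⇒∈ q))
  at-injective (x≢ ∷ _)    (there p) here      = contradiction refl (All.lookup x≢ (at⇒∈ p))
  at-injective (_ ∷ xs!)   (there p) (there q) = cong suc (at-injective xs! p q)

  at-++ˡ : ∀ {xs ys : List A} {i x} → At xs i x → At (xs ++ ys) i x
  at-++ˡ here      = here
  at-++ˡ (there p) = there (at-++ˡ p)

  zip⇒at : ∀ (x : A) xs {z u v} → (u , v) ∈ zip (x ∷ xs) (xs ++ [ z ]) →
           ∃ λ i → At (x ∷ xs) i u × (At (x ∷ xs) (suc i) v ⊎ (suc i ≡ length (x ∷ xs) × v ≡ z))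
  zip⇒at x []       (here refl) = 0 , here , inj₂ (refl , refl)
  zip⇒at x (y ∷ xs) (here refl) = 0 , here , inj₁ (there here)
  zip⇒at x (y ∷ xs) (there uv∈) with zip⇒at y xs uv∈
  ... | i , p , q = suc i , there p , Sum.map there (λ { (e , v≡z) → cong suc e , v≡z }) q

  at⇒zip : ∀ (x : A) xs {z i u v} → At (x ∷ xs) i u →
           At (x ∷ xs) (suc i) v ⊎ (suc i ≡ length (x ∷ xs) × v ≡ z) →
           (u , v) ∈ zip (x ∷ xs) (xs ++ [ z ])
  at⇒zip x []       here      (inj₁ (there ()))
  at⇒zip x []       here      (inj₂ (_ , refl)) = here refl
  at⇒zip x (y ∷ xs) here      (inj₁ (there here)) = here refl
  at⇒zip x (y ∷ xs) (there p) (inj₁ (there q)) = there (at⇒zip y xs p (inj₁ q))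
  at⇒zip x (y ∷ xs) (there p) (inj₂ (e , v≡z)) = there (at⇒zip y xs p (inj₂ (ℕₚ.suc-injective e , v≡z)))

Next : ℕ → ℕ → ℕ → Set
Next g i j = suc i ≡ j ⊎ (suc i ≡ g × j ≡ 0)

module _ {A : Set} where

  cyclePairs⇒next : ∀ {xs : List A} {u v} → (u , v) ∈ cyclePairs xs →
                    ∃₂ λ i j → At xs i u × At xs j v × Next (length xs) i j
  cyclePairs⇒next {x ∷ xs} uv∈ with zip⇒at x xs uv∈
  ... | i , p , inj₁ q          = i , suc i , p , q , inj₁ refl
  ... | i , p , inj₂ (e , refl) = i , 0 , p , here , inj₂ (e , refl)

  next⇒cyclePairs : ∀ {xs : List A} {i j u v} → At xs i u → At xs j v → Next (length xs) i j →
                    (u , v) ∈ cyclePairs xs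
  next⇒cyclePairs {x ∷ xs} p q    (inj₁ refl)       = at⇒zip x xs p (inj₁ q)
  next⇒cyclePairs {x ∷ xs} p here (inj₂ (e , refl)) = at⇒zip x xs p (inj₂ (e , refl))

next-functional : ∀ {g i j j′} → j < g → j′ < g → Next g i j → Next g i j′ → j ≡ j′
next-functional _   _    (inj₁ refl)       (inj₁ refl)       = refl
next-functional j<g _    (inj₁ refl)       (inj₂ (refl , _)) = contradiction j<g (ℕₚ.<-irrefl refl)
next-functional _   j′<g (inj₂ (refl , _)) (inj₁ refl)       = contradiction j′<g (ℕₚ.<-irrefl refl)
next-functional _   _    (inj₂ (_ , refl)) (inj₂ (_ , refl)) = refl

next-injective : ∀ {g i i′ j} → Next g i j → Next g i′ j → i ≡ i′
next-injective (inj₁ refl)       (inj₁ refl)       = refl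
next-injective (inj₂ (refl , _)) (inj₂ (refl , _)) = refl
next-injective (inj₁ refl)       (inj₂ (_ , ()))
next-injective (inj₂ (_ , refl)) (inj₁ ())

-- This is where a cycle must have length at least 3: for `g = 2` the positions 0 and 1 follow each
-- other.
next-asym : ∀ {g i j} → 3 ≤ g → Next g i j → ¬ Next g j i
next-asym _  (inj₁ refl)          (inj₁ e)             = ℕₚ.<-irrefl (sym e) (ℕₚ.m<n⇒m<1+n ℕₚ.≤-refl)
next-asym (s≤s (s≤s ())) (inj₁ refl) (inj₂ (refl , refl))
next-asym (s≤s (s≤s ())) (inj₂ (refl , refl)) (inj₁ refl)

next-exists : ∀ {g i} → i < g → ∃ λ j → j < g × Next g i j
next-exists {g} {i} i<g with suc i ℕ.≟ g
... | yes refl = 0 , s≤s z≤n , inj₂ (refl , refl)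
... | no 1+i≢g = suc i , ℕₚ.≤∧≢⇒< i<g 1+i≢g , inj₁ refl

prev-exists : ∀ {g j} → j < g → ∃ λ i → i < g × Next g i j
prev-exists {suc g} {zero}  _   = g , ℕₚ.≤-refl , inj₂ (refl , refl)
prev-exists {g}     {suc j} j<g = j , ℕₚ.<-trans ℕₚ.≤-refl j<g , inj₁ refl

module _ {A : Set} {vs : List A} (vs! : Unique vs) where

  cyclePairs-functional : ∀ {u v v′} → (u , v) ∈ cyclePairs vs → (u , v′) ∈ cyclePairs vs → v ≡ v′
  cyclePairs-functional uv uv′ with cyclePairs⇒next uv | cyclePairs⇒next uv′
  ... | i , j , p , q , nx | i′ , j′ , p′ , q′ , nx′ with at-injective vs! p p′
  ... | refl with next-functional (at⇒< q) (at⇒< q′) nx nx′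
  ... | refl = at-functional q q′

  cyclePairs-injective : ∀ {u u′ v} → (u , v) ∈ cyclePairs vs → (u′ , v) ∈ cyclePairs vs → u ≡ u′
  cyclePairs-injective uv u′v with cyclePairs⇒next uv | cyclePairs⇒next u′v
  ... | i , j , p , q , nx | i′ , j′ , p′ , q′ , nx′ with at-injective vs! q q′
  ... | refl with next-injective nx nx′
  ... | refl = at-functional p p′

  cyclePairs-asym : 3 ≤ length vs → ∀ {u v} → (u , v) ∈ cyclePairs vs → (v , u) ∉ cyclePairs vs
  cyclePairs-asym 3≤ uv vu with cyclePairs⇒next uv | cyclePairs⇒next vu
  ... | i , j , p , q , nx | j′ , i′ , q′ , p′ , nx′ with at-injective vs! p p′ | at-injective vs! q q′
  ... | refl | refl = next-asym 3≤ nx nx′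

module _ {A : Set} {vs : List A} where

  cyclePairs⇒∈ : ∀ {u v} → (u , v) ∈ cyclePairs vs → u ∈ vs × v ∈ vs
  cyclePairs⇒∈ uv with cyclePairs⇒next uv
  ... | _ , _ , p , q , _ = at⇒∈ p , at⇒∈ q

  successor : ∀ {u} → u ∈ vs → ∃ λ v → (u , v) ∈ cyclePairs vs
  successor u∈ with ∈⇒at u∈
  ... | i , p with next-exists (at⇒< p)
  ... | j , j<g , nx with <⇒at j<g
  ... | v , q = v , next⇒cyclePairs p q nx

  predecessor : ∀ {v} → v ∈ vs → ∃ λ u → (u , v) ∈ cyclePairs vs
  predecessor v∈ with ∈⇒at v∈
  ... | j , q with prev-exists (at⇒< q)
  ... | i , i<g , nx with <⇒at i<g
  ... | u , p = u , next⇒cyclePairs p q nx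

module _ {A : Set} where

  zip-pairs-length : ∀ (x : A) xs z → length (zip (x ∷ xs) (xs ++ [ z ])) ≡ suc (length xs)
  zip-pairs-length x []       z = refl
  zip-pairs-length x (y ∷ xs) z = cong suc (zip-pairs-length y xs z)

  cyclePairs-length : ∀ (xs : List A) → length (cyclePairs xs) ≡ length xs
  cyclePairs-length []       = refl
  cyclePairs-length (x ∷ xs) = zip-pairs-length x xs x

  module _ (f : A → ℕ) where

    zip-pairs-sum : ∀ x xs z → sum (map (λ e → f (proj₁ e) + f (proj₂ e)) (zip (x ∷ xs) (xs ++ [ z ])))
                               ≡ f x + 2 * sum (map f xs) + f z
    zip-pairs-sum x []       z = eq (f x) (f z)
      where
      eq : ∀ a b → a + b + 0 ≡ a + 2 * 0 + b
      eq = solve-∀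
    zip-pairs-sum x (y ∷ xs) z rewrite zip-pairs-sum y xs z = eq (f x) (f y) (sum (map f xs)) (f z)
      where
      eq : ∀ a b s c → a + b + (b + 2 * s + c) ≡ a + 2 * (b + s) + c
      eq = solve-∀

    -- Each position of the cycle occurs once as a first entry and once as a second entry.
    cyclePairs-sum : ∀ xs → sum (map (λ e → f (proj₁ e) + f (proj₂ e)) (cyclePairs xs)) ≡ 2 * sum (map f xs)
    cyclePairs-sum []       = refl
    cyclePairs-sum (x ∷ xs) = trans (zip-pairs-sum x xs x) (eq (f x) (sum (map f xs)))
      where
      eq : ∀ a s → a + 2 * s + a ≡ 2 * (a + s)
      eq = solve-∀

-- Counting by fibres

indicator-sum : ∀ {A : Set} {P : A → Set} (P? : Decidable P) xs →
                sum (map (λ x → if does (P? x) then 1 else 0) xs) ≡ length (filter P? xs)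
indicator-sum P? [] = refl
indicator-sum P? (x ∷ xs) with does (P? x)
... | true  = cong suc (indicator-sum P? xs)
... | false = indicator-sum P? xs

module _ {A : Set} (_≟_ : DecidableEquality A) where

  δ : A → A → ℕ
  δ x y = if does (y ≟ x) then 1 else 0

  δ-refl : ∀ x → δ x x ≡ 1
  δ-refl x with x ≟ x
  ... | yes _ = refl
  ... | no x≢x = contradiction refl x≢x

  δ-≢ : ∀ {x y} → y ≢ x → δ x y ≡ 0
  δ-≢ {x} {y} y≢x with y ≟ x
  ... | yes y≡x = contradiction y≡x y≢x
  ... | no _ = refl

  sum-δ-∉ : ∀ {x xs} → x ∉ xs → sum (map (δ x) xs) ≡ 0
  sum-δ-∉ {x} {[]} _ = refl
  sum-δ-∉ {x} {y ∷ xs} x∉ rewrite δ-≢ {x} {y} (λ y≡x → x∉ (here (sym y≡x))) = sum-δ-∉ (x∉ ∘ there)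

  sum-δ-∈ : ∀ {x xs} → Unique xs → x ∈ xs → sum (map (δ x) xs) ≡ 1
  sum-δ-∈ {x} (x≢ ∷ xs!) (here refl) rewrite δ-refl x = cong suc (sum-δ-∉ (λ x∈ → All.lookup x≢ x∈ refl))
  sum-δ-∈ {x} (y≢ ∷ xs!) (there x∈) rewrite δ-≢ {x} (All.lookup y≢ x∈) = sum-δ-∈ xs! x∈

  sum-δ≤1 : ∀ {x xs} → Unique xs → sum (map (δ x) xs) ≤ 1
  sum-δ≤1 {x} {xs} xs! with Any.any? (x ≟_) xs
  ... | yes x∈ = ℕₚ.≤-reflexive (sum-δ-∈ xs! x∈)
  ... | no x∉  = subst (_≤ 1) (sym (sum-δ-∉ x∉)) z≤n

  module _ {B : Set} (f : B → A) where

    fibre : A → List B → List B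
    fibre a = filter (λ b → f b ≟ a)

    fibre-∷ : ∀ a b bs → length (fibre a (b ∷ bs)) ≡ δ (f b) a + length (fibre a bs)
    fibre-∷ a b bs with f b ≟ a | a ≟ f b
    ... | yes _    | yes _    = refl
    ... | no _     | no _     = refl
    ... | yes fb≡a | no a≢fb  = contradiction (sym fb≡a) a≢fb
    ... | no fb≢a  | yes a≡fb = contradiction (sym a≡fb) fb≢a

    -- Fibres over distinct points are disjoint: a new `b` enlarges only the fibre over `f b`, which
    -- is counted at most once.
    sum-fibres≤ : ∀ {as} → Unique as → ∀ bs → sum (map (λ a → length (fibre a bs)) as) ≤ length bs
    sum-fibres≤ {as} as! [] = ℕₚ.≤-reflexive (zeros as)
      where
      zeros : ∀ (as : List A) → sum (map (λ _ → 0) as) ≡ 0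
      zeros []       = refl
      zeros (_ ∷ as) = zeros as
    sum-fibres≤ {as} as! (b ∷ bs) = begin
      sum (map (λ a → length (fibre a (b ∷ bs))) as)                          ≡⟨ cong sum (Listₚ.map-cong (λ a → fibre-∷ a b bs) as) ⟩
      sum (map (λ a → δ (f b) a + length (fibre a bs)) as)                    ≡⟨ sum-map-+ (δ (f b)) _ as ⟩
      sum (map (δ (f b)) as) + sum (map (λ a → length (fibre a bs)) as)       ≤⟨ ℕₚ.+-mono-≤ (sum-δ≤1 as!) (sum-fibres≤ as! bs) ⟩
      suc (length bs)                                                         ∎
      where
      open ℕₚ.≤-Reasoning
      sum-map-+ : ∀ (g h : A → ℕ) xs → sum (map (λ a → g a + h a) xs) ≡ sum (map g xs) + sum (map h xs)
      sum-map-+ g h [] = refl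
      sum-map-+ g h (x ∷ xs) rewrite sum-map-+ g h xs = eq (g x) (h x) (sum (map g xs)) (sum (map h xs))
        where
        eq : ∀ a b c d → a + b + (c + d) ≡ a + c + (b + d)
        eq = solve-∀

-- Degrees

module _ {n} (G : Graph n) where

  neighbours : Fin n → List (Fin n)
  neighbours v = filter (λ u → adj G v u Bool.≟ true) (allFin n)

  degree≡ : ∀ v → degree G v ≡ length (neighbours v)
  degree≡ v = lemma (allFin n)
    where
    lemma : ∀ us → sum (map (λ u → if adj G v u then 1 else 0) us) ≡
                   length (filter (λ u → adj G v u Bool.≟ true) us)
    lemma [] = refl
    lemma (u ∷ us) with adj G v u
    ... | true  = cong suc (lemma us)
    ... | false = lemma us

  degree≤ : ∀ v {us} → (∀ {u} → Adj G v u → u ∈ us) → degree G v ≤ length us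
  degree≤ v nbrs⊆ rewrite degree≡ v = unique-⊆⇒length≤ (Uniqueₚ.filter⁺ _ (Uniqueₚ.allFin⁺ n))
    (λ u∈ → nbrs⊆ (proj₂ (∈ₚ.∈-filter⁻ (λ u → adj G v u Bool.≟ true) {xs = allFin n} u∈)))

  degree≥ : ∀ v {us} → Unique us → (∀ {u} → u ∈ us → Adj G v u) → length us ≤ degree G v
  degree≥ v us! us⊆ rewrite degree≡ v = unique-⊆⇒length≤ us!
    (λ u∈ → ∈ₚ.∈-filter⁺ (λ u → adj G v u Bool.≟ true) (∈ₚ.∈-allFin _) (us⊆ u∈))

  degree≥1 : ∀ {u v} → Adj G u v → 1 ≤ degree G u
  degree≥1 {u} {v} uv = degree≥ u {v ∷ []} ([] ∷ []) (λ { (here refl) → uv })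

  ω : Fin n × Fin n → ℕ
  ω (u , v) = degree G u * degree G u + degree G v * degree G v

  ω-comm : ∀ u v → ω (u , v) ≡ ω (v , u)
  ω-comm u v = ℕₚ.+-comm (degree G u * degree G u) _

module Degrees {n} (G : Graph n) (connected : Connected G)
  (unique-cycle : ∀ vs ws → IsCycle G vs → IsCycle G ws → ∀ u v → CycleEdge vs u v → CycleEdge ws u v)
  (C : List (Fin n)) (C-cycle : IsCycle G C) where

  open Structure G connected unique-cycle C C-cycle public
  open import Data.List.Membership.DecPropositional (Finₚ._≟_ {n}) using (_∈?_)

  C! : Unique C
  C! = proj₁ C-cycle

  3≤g : 3 ≤ length C
  3≤g = proj₁ (proj₂ C-cycle)

  k : ℕ
  k = n ∸ length C

  off : List (Fin n)
  off = filter (λ v → ¬? (v ∈? C)) (allFin n)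

  off⁺ : ∀ {v} → v ∉ C → v ∈ off
  off⁺ = ∈ₚ.∈-filter⁺ (λ v → ¬? (v ∈? C)) (∈ₚ.∈-allFin _)

  off⁻ : ∀ {v} → v ∈ off → v ∉ C
  off⁻ v∈ = proj₂ (∈ₚ.∈-filter⁻ (λ v → ¬? (v ∈? C)) {xs = allFin n} v∈)

  off! : Unique off
  off! = Uniqueₚ.filter⁺ _ (Uniqueₚ.allFin⁺ n)

  -- `C ++ off` lists every vertex exactly once. This gives the size of `off`, and the same list
  -- later numbers the vertices for the isomorphism.
  C++off! : Unique (C ++ off)
  C++off! = Uniqueₚ.++⁺ C! off! (λ { (v∈C , v∈off) → off⁻ v∈off v∈C })

  ∈-C++off : ∀ v → v ∈ C ++ off
  ∈-C++off v with v ∈? C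
  ... | yes v∈C = ∈ₚ.∈-++⁺ˡ v∈C
  ... | no v∉C  = ∈ₚ.∈-++⁺ʳ C (off⁺ v∉C)

  length-C++off : length C + length off ≡ n
  length-C++off = trans (sym (Listₚ.length-++ C)) (ℕₚ.≤-antisym
    (subst (length (C ++ off) ≤_) (Listₚ.length-tabulate {n = n} _) (unique-⊆⇒length≤ C++off! (λ _ → ∈ₚ.∈-allFin _)))
    (subst (_≤ length (C ++ off)) (Listₚ.length-tabulate {n = n} _) (unique-⊆⇒length≤ (Uniqueₚ.allFin⁺ n) (λ _ → ∈-C++off _))))

  length-off : length off ≡ k
  length-off = sym (trans (cong (_∸ length C) (sym length-C++off)) (ℕₚ.m+n∸m≡n (length C) _))

  children : Fin n → List (Fin n)
  children u = fibre Finₚ._≟_ parent u off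

  ch : Fin n → ℕ
  ch u = length (children u)

  sum-ch≤k : ∀ {us} → Unique us → sum (map ch us) ≤ k
  sum-ch≤k {us} us! = subst (sum (map ch us) ≤_) length-off (sum-fibres≤ Finₚ._≟_ parent us! off)

  ch-pair≤k : ∀ {u v} → u ≢ v → ch u + ch v ≤ k
  ch-pair≤k {u} {v} u≢v = subst (λ m → ch u + m ≤ k) (ℕₚ.+-identityʳ (ch v))
    (sum-ch≤k {u ∷ v ∷ []} ((u≢v ∷ []) ∷ [] ∷ []))

  Adj⇒≢ : ∀ {u v} → Adj G u v → u ≢ v
  Adj⇒≢ uv refl = Adj-irrefl uv

  treeEdge⇒child : ∀ {u v} → TreeEdge v u → v ∈ children u
  treeEdge⇒child {u} (v∉C , e) = ∈ₚ.∈-filter⁺ (λ v → parent v Finₚ.≟ u) (off⁺ v∉C) e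

  degree-on : ∀ {u} → u ∈ C → degree G u ≤ 2 + ch u
  degree-on {u} u∈C with successor u∈C | predecessor u∈C
  ... | s , us | p , pu = degree≤ G u {s ∷ p ∷ children u} nbr
    where
    nbr : ∀ {v} → Adj G u v → v ∈ s ∷ p ∷ children u
    nbr uv with edge-cases uv
    ... | inj₁ (inj₁ uv∈)      = here (cyclePairs-functional C! uv∈ us)
    ... | inj₁ (inj₂ vu∈)      = there (here (cyclePairs-injective C! vu∈ pu))
    ... | inj₂ (inj₁ (u∉C , _)) = contradiction u∈C u∉C
    ... | inj₂ (inj₂ t)        = there (there (treeEdge⇒child t))

  degree-off : ∀ {u} → u ∉ C → degree G u ≤ 1 + ch u
  degree-off {u} u∉C = degree≤ G u {parent u ∷ children u} nbr
    where
    nbr : ∀ {v} → Adj G u v → v ∈ parent u ∷ children u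
    nbr uv with edge-cases uv
    ... | inj₁ (inj₁ uv∈)     = contradiction (proj₁ (cyclePairs⇒∈ uv∈)) u∉C
    ... | inj₁ (inj₂ vu∈)     = contradiction (proj₂ (cyclePairs⇒∈ vu∈)) u∉C
    ... | inj₂ (inj₁ (_ , e)) = here (sym e)
    ... | inj₂ (inj₂ t)       = there (treeEdge⇒child t)

  degree≤2+ch : ∀ u → degree G u ≤ 2 + ch u
  degree≤2+ch u with u ∈? C
  ... | yes u∈C = degree-on u∈C
  ... | no u∉C  = ℕₚ.m≤n⇒m≤1+n (degree-off u∉C)

  degree≥2 : ∀ {u} → u ∈ C → 2 ≤ degree G u
  degree≥2 {u} u∈C with successor u∈C | predecessor u∈C
  ... | s , us | p , pu = degree≥ G u {s ∷ p ∷ []} ((s≢p ∷ []) ∷ [] ∷ [])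
      λ { (here refl) → cycleEdge-adj (inj₁ us) ; (there (here refl)) → cycleEdge-adj (inj₂ pu) }
    where
    s≢p : s ≢ p
    s≢p refl = cyclePairs-asym C! 3≤g us pu

  treeEdge-degrees : ∀ {v} → v ∉ C → degree G v + degree G (parent v) ≤ k + 3
  treeEdge-degrees {v} v∉C = begin
    degree G v + degree G (parent v)          ≤⟨ ℕₚ.+-mono-≤ (degree-off v∉C) (degree≤2+ch (parent v)) ⟩
    1 + ch v + (2 + ch (parent v))            ≡⟨ eq (ch v) (ch (parent v)) ⟩
    ch v + ch (parent v) + 3                  ≤⟨ ℕₚ.+-monoˡ-≤ 3 (ch-pair≤k (Adj⇒≢ (parent-adj v∉C))) ⟩
    k + 3                                     ∎
    where
    open ℕₚ.≤-Reasoning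
    eq : ∀ a b → 1 + a + (2 + b) ≡ a + b + 3
    eq = solve-∀

  -- By convexity, the sum of squares of two positive degrees with sum at most `k + 3` is extremal
  -- at `(1 , k + 2)`, a pendent edge at a hub.
  ω-tree≤ : ∀ {v} → v ∉ C → ω G (v , parent v) ≤ (k + 2) * (k + 2) + 1
  ω-tree≤ {v} v∉C = lemma (degree≥1 G (parent-adj v∉C)) (degree≥1 G (Adj-sym (parent-adj v∉C))) (treeEdge-degrees v∉C)
    where
    lemma : ∀ {d e k} → 1 ≤ d → 1 ≤ e → d + e ≤ k + 3 → d * d + e * e ≤ (k + 2) * (k + 2) + 1
    lemma {suc d} {suc e} {k} _ _ le = ℕₚ.≤-trans (≤-by (2 * d * e) (eq d e))
      (ℕₚ.+-monoˡ-≤ 1 (ℕₚ.*-mono-≤ le′ le′))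
      where
      eq : ∀ d e → suc d * suc d + suc e * suc e + 2 * d * e ≡ (1 + d + e) * (1 + d + e) + 1
      eq = solve-∀
      le′ : 1 + d + e ≤ k + 2
      le′ = ℕₚ.≤-pred (subst₂ _≤_ (cong suc (ℕₚ.+-suc d e)) (ℕₚ.+-suc k 2) le)

  -- With degree `k + 2` excluded, the extreme point for two degrees of at least 2 moves to
  -- `(2 , k + 1)`. If one degree is at most 1, the other contributes at most `(k + 1)²`, which also
  -- fits.
  ω-tree< : 1 ≤ k → (∀ v → degree G v ≤ k + 1) → ∀ {v} → v ∉ C → ω G (v , parent v) ≤ (k + 1) * (k + 1) + 4
  ω-tree< 1≤k ≤k+1 {v} v∉C = lemma 1≤k (≤k+1 v) (≤k+1 (parent v)) (treeEdge-degrees v∉C)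
    where
    sq : ∀ {a b} → a ≤ b → a * a ≤ b * b
    sq a≤b = ℕₚ.*-mono-≤ a≤b a≤b
    lemma : ∀ {d e k} → 1 ≤ k → d ≤ k + 1 → e ≤ k + 1 → d + e ≤ k + 3 → d * d + e * e ≤ (k + 1) * (k + 1) + 4
    lemma {d} {e} {k} 1≤k d≤ e≤ le with d ℕ.≤? 1 | e ℕ.≤? 1
    ... | yes d≤1 | _ = subst (_≤ (k + 1) * (k + 1) + 4) (ℕₚ.+-comm (e * e) (d * d))
                          (ℕₚ.+-mono-≤ (sq e≤) (ℕₚ.≤-trans (sq d≤1) (s≤s z≤n)))
    ... | no _ | yes e≤1 = ℕₚ.+-mono-≤ (sq d≤) (ℕₚ.≤-trans (sq e≤1) (s≤s z≤n))
    ... | no d≰1 | no e≰1 = big (ℕₚ.≰⇒> d≰1) (ℕₚ.≰⇒> e≰1) le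
      where
      big : ∀ {d e} → 2 ≤ d → 2 ≤ e → d + e ≤ k + 3 → d * d + e * e ≤ (k + 1) * (k + 1) + 4
      big {suc zero} (s≤s ()) _ _
      big {suc (suc d)} {suc zero} _ (s≤s ()) _
      big {suc (suc d)} {suc (suc e)} _ _ le = ℕₚ.≤-trans (≤-by (2 * d * e) (eq d e)) (ℕₚ.+-monoˡ-≤ 4 (sq le′))
        where
        eq : ∀ d e → suc (suc d) * suc (suc d) + suc (suc e) * suc (suc e) + 2 * d * e ≡ (2 + d + e) * (2 + d + e) + 4
        eq = solve-∀
        eq′ : ∀ d e → suc (suc d) + suc (suc e) ≡ 2 + (2 + d + e)
        eq′ = solve-∀
        le′ : 2 + d + e ≤ k + 1
        le′ = ℕₚ.+-cancelˡ-≤ 2 _ _ (subst₂ _≤_ (eq′ d e) (trans (ℕₚ.+-comm k 3) (cong (λ m → 2 + m) (ℕₚ.+-comm 1 k))) le)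

  ω-cycle≤ : ∀ u v → ω G (u , v) ≤ (2 + ch u) * (2 + ch u) + (2 + ch v) * (2 + ch v)
  ω-cycle≤ u v = ℕₚ.+-mono-≤ (ℕₚ.*-mono-≤ (degree≤2+ch u) (degree≤2+ch u)) (ℕₚ.*-mono-≤ (degree≤2+ch v) (degree≤2+ch v))

  -- The largest possible degree; it forces w onto C with all n − g other vertices pendent at w.
  IsHub : Fin n → Set
  IsHub w = k + 2 ≤ degree G w

  hub∈C : ∀ {w} → IsHub w → w ∈ C
  hub∈C {w} hub with w ∈? C
  ... | yes w∈C = w∈C
  ... | no w∉C = contradiction
      (ℕₚ.≤-trans hub (ℕₚ.≤-trans (degree-off w∉C) (s≤s (ℕₚ.≤-trans (ℕₚ.m≤m+n _ 0) (sum-ch≤k {w ∷ []} ([] ∷ []))))))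
      (ℕₚ.<⇒≱ (ℕₚ.≤-reflexive (ℕₚ.+-comm 2 k)))

  -- Degree `k + 2` forces `w` to have at least `k` children, and only `k` vertices lie off `C`, so
  -- the filter defining `children w` removes none of them.
  hub-parent : ∀ {w} → IsHub w → ∀ {v} → v ∉ C → parent v ≡ w
  hub-parent {w} hub {v} v∉C = proj₂ (∈ₚ.∈-filter⁻ (λ v → parent v Finₚ.≟ w) {xs = off}
    (subst (v ∈_) (sym all-children) (off⁺ v∉C)))
    where
    k≤ch : k ≤ ch w
    k≤ch = ℕₚ.+-cancelʳ-≤ 2 k (ch w) (ℕₚ.≤-trans hub (subst (degree G w ≤_) (ℕₚ.+-comm 2 (ch w)) (degree≤2+ch w)))
    all-children : children w ≡ off
    all-children = Listₚ.filter-complete (λ v → parent v Finₚ.≟ w)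
      (ℕₚ.≤-antisym (Listₚ.length-filter _ off) (subst (_≤ ch w) (sym length-off) k≤ch))

-- Sums over the edge list

Σℚ : ∀ {A : Set} → (A → ℚ) → List A → ℚ
Σℚ f []       = 0ℚ
Σℚ f (x ∷ xs) = f x ℚ.+ Σℚ f xs

module _ {A : Set} (f : A → ℚ) where

  Σℚ-++ : ∀ xs ys → Σℚ f (xs ++ ys) ≡ Σℚ f xs ℚ.+ Σℚ f ys
  Σℚ-++ []       ys = sym (ℚₚ.+-identityˡ _)
  Σℚ-++ (x ∷ xs) ys = trans (cong (f x ℚ.+_) (Σℚ-++ xs ys)) (sym (ℚₚ.+-assoc (f x) _ _))

  Σℚ-↭ : ∀ {xs ys} → xs ↭ ys → Σℚ f xs ≡ Σℚ f ys
  Σℚ-↭ Perm.refl          = refl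
  Σℚ-↭ (Perm.prep x p)    = cong (f x ℚ.+_) (Σℚ-↭ p)
  Σℚ-↭ (Perm.swap {xs} {ys} x y p) = trans (cong (λ s → f x ℚ.+ (f y ℚ.+ s)) (Σℚ-↭ p))
    (solve 3 (λ a b s → a :+ (b :+ s) := b :+ (a :+ s)) refl (f x) (f y) (Σℚ f ys))
    where open ℚSolver.+-*-Solver
  Σℚ-↭ (Perm.trans p q)   = trans (Σℚ-↭ p) (Σℚ-↭ q)

  Σℚ-nonneg : ∀ {xs} → All (λ x → 0ℚ ℚ.≤ f x) xs → 0ℚ ℚ.≤ Σℚ f xs
  Σℚ-nonneg []          = ℚₚ.≤-refl
  Σℚ-nonneg (0≤fx ∷ 0≤) = 0≤+ 0≤fx (Σℚ-nonneg 0≤)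

  Σℚ-scale : ∀ c xs → Σℚ (λ x → c ℚ.* f x) xs ≡ c ℚ.* Σℚ f xs
  Σℚ-scale c []       = sym (ℚₚ.*-zeroʳ c)
  Σℚ-scale c (x ∷ xs) = trans (cong (c ℚ.* f x ℚ.+_) (Σℚ-scale c xs)) (sym (ℚₚ.*-distribˡ-+ c (f x) _))

  Σℚ-map : ∀ {B : Set} (h : B → A) xs → Σℚ f (map h xs) ≡ Σℚ (λ x → f (h x)) xs
  Σℚ-map h []       = refl
  Σℚ-map h (x ∷ xs) = cong (f (h x) ℚ.+_) (Σℚ-map h xs)

Σℚ-const : ∀ {A : Set} c (xs : List A) → Σℚ (λ _ → c) xs ≡ ι (length xs) ℚ.* c
Σℚ-const c []       = sym (trans (cong (ℚ._* c) ι0) (ℚₚ.*-zeroˡ c))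
Σℚ-const c (x ∷ xs) = begin
  c ℚ.+ Σℚ (λ _ → c) xs            ≡⟨ cong (c ℚ.+_) (Σℚ-const c xs) ⟩
  c ℚ.+ ι (length xs) ℚ.* c        ≡⟨ solve 2 (λ c m → c :+ m :* c := (con 1ℚ :+ m) :* c) refl c (ι (length xs)) ⟩
  (1ℚ ℚ.+ ι (length xs)) ℚ.* c     ≡⟨ cong (ℚ._* c) (trans (cong (ℚ._+ ι (length xs)) (sym ι1)) (sym (ι-+ 1 (length xs)))) ⟩
  ι (suc (length xs)) ℚ.* c        ∎
  where open ≡-Reasoning
        open ℚSolver.+-*-Solver

Σℚ-affine : ∀ {A : Set} c d (t : A → ℕ) xs →
            Σℚ (λ x → c ℚ.+ ι (t x) ℚ.* d) xs ≡ ι (length xs) ℚ.* c ℚ.+ ι (sum (map t xs)) ℚ.* d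
Σℚ-affine c d t [] rewrite ι0 | ℚₚ.*-zeroˡ c | ℚₚ.*-zeroˡ d = refl
Σℚ-affine c d t (x ∷ xs) = begin
  c ℚ.+ ι (t x) ℚ.* d ℚ.+ Σℚ (λ x → c ℚ.+ ι (t x) ℚ.* d) xs
    ≡⟨ cong (c ℚ.+ ι (t x) ℚ.* d ℚ.+_) (Σℚ-affine c d t xs) ⟩
  c ℚ.+ ι (t x) ℚ.* d ℚ.+ (ι (length xs) ℚ.* c ℚ.+ ι (sum (map t xs)) ℚ.* d)
    ≡⟨ solve 5 (λ c d a m s → c :+ a :* d :+ (m :* c :+ s :* d) := (con 1ℚ :+ m) :* c :+ (a :+ s) :* d)
         refl c d (ι (t x)) (ι (length xs)) (ι (sum (map t xs))) ⟩
  (1ℚ ℚ.+ ι (length xs)) ℚ.* c ℚ.+ (ι (t x) ℚ.+ ι (sum (map t xs))) ℚ.* d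
    ≡⟨ cong₂ (λ m s → m ℚ.* c ℚ.+ s ℚ.* d) (trans (cong (ℚ._+ ι (length xs)) (sym ι1)) (sym (ι-+ 1 (length xs)))) (sym (ι-+ (t x) _)) ⟩
  ι (suc (length xs)) ℚ.* c ℚ.+ ι (t x + sum (map t xs)) ℚ.* d ∎
  where open ≡-Reasoning
        open ℚSolver.+-*-Solver

module _ {A B : Set} (R : A → B → Set) (w : A → ℚ) (w′ : B → ℚ)
         (R⇒≤ : ∀ {x y} → R x y → w x ℚ.≤ w′ y) where

  Σℚ-pointwise : ∀ {xs ys} → Pointwise R xs ys → Σℚ w xs ℚ.≤ Σℚ w′ ys
  Σℚ-pointwise []       = ℚₚ.≤-refl
  Σℚ-pointwise (r ∷ rs) = ℚₚ.+-mono-≤ (R⇒≤ r) (Σℚ-pointwise rs)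

  -- The matched part of `ys` dominates term by term; the leftovers can only increase the right-hand
  -- sum.
  Σℚ-dominated : ∀ {xs ys} → All (λ y → 0ℚ ℚ.≤ w′ y) ys →
                 AllPairs (λ x x′ → ∀ y → R x y → ¬ R x′ y) xs → All (λ x → Any (R x) ys) xs → Σℚ w xs ℚ.≤ Σℚ w′ ys
  Σℚ-dominated {xs} {ys} 0≤w′ xs# xs~ with matching R ys xs# xs~
  ... | ws , zs , xs~ws , ys↭ = begin
    Σℚ w xs                   ≤⟨ Σℚ-pointwise xs~ws ⟩
    Σℚ w′ ws                  ≡⟨ ℚₚ.+-identityʳ _ ⟨
    Σℚ w′ ws ℚ.+ 0ℚ           ≤⟨ ℚₚ.+-monoʳ-≤ (Σℚ w′ ws) (Σℚ-nonneg w′ (Allₚ.++⁻ʳ ws (Permₚ.All-resp-↭ ys↭ 0≤w′))) ⟩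
    Σℚ w′ ws ℚ.+ Σℚ w′ zs     ≡⟨ Σℚ-++ w′ ws zs ⟨
    Σℚ w′ (ws ++ zs)          ≡⟨ Σℚ-↭ w′ ys↭ ⟨
    Σℚ w′ ys                  ∎
    where open ℚₚ.≤-Reasoning

module _ {A : Set} (f : A → ℕ) {P : ℕ → ℚ → Set} where

  SqrtTerms : List A → SqrtSum
  SqrtTerms = map (λ e → 1 , f e)

  -- The approximations form an `All` indexed by the edge list. Pairing each rational with its edge
  -- gives a plain list that can be matched and permuted, with entries that stay distinct even when
  -- rationals coincide.
  tagged : ∀ es → All (λ t → Σ ℚ (P (proj₂ t))) (SqrtTerms es) → List (A × ℚ)
  tagged []       []             = []
  tagged (e ∷ es) ((q , _) ∷ ps) = (e , q) ∷ tagged es ps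

  tagged-fst : ∀ es ps → map proj₁ (tagged es ps) ≡ es
  tagged-fst []       []       = refl
  tagged-fst (e ∷ es) (_ ∷ ps) = cong (e ∷_) (tagged-fst es ps)

  tagged-snd : ∀ es ps → All (λ t → P (f (proj₁ t)) (proj₂ t)) (tagged es ps)
  tagged-snd []       []             = []
  tagged-snd (e ∷ es) ((_ , p) ∷ ps) = p ∷ tagged-snd es ps

  tagged-sum : ∀ es ps → evalApprox ps ≡ Σℚ proj₂ (tagged es ps)
  tagged-sum []       []             = refl
  tagged-sum (e ∷ es) ((q , _) ∷ ps) = cong₂ ℚ._+_ (ℚₚ.*-identityˡ q) (tagged-sum es ps)

  tagged-∈⁻ : ∀ {es ps t} → t ∈ tagged es ps → proj₁ t ∈ es
  tagged-∈⁻ {[]}    {[]}    ()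
  tagged-∈⁻ {_ ∷ _} {_ ∷ _} (here refl) = here refl
  tagged-∈⁻ {_ ∷ _} {_ ∷ _} (there t∈)  = there (tagged-∈⁻ t∈)

  tagged-∈⁺ : ∀ {es ps e} → e ∈ es → ∃ λ t → t ∈ tagged es ps × proj₁ t ≡ e
  tagged-∈⁺ {[]}    {[]}    ()
  tagged-∈⁺ {_ ∷ _} {_ ∷ _} (here refl) = _ , here refl , refl
  tagged-∈⁺ {_ ∷ _} {_ ∷ _} (there e∈) with tagged-∈⁺ e∈
  ... | t , t∈ , t≡e = t , there t∈ , t≡e

-- Turns the nested loops of `SO` into a filtered product, for which uniqueness and membership are
-- immediate.
filter-cartesianProduct : ∀ {A B C : Set} (b : A → B → Bool) (h : A → B → C) xs ys →
  concatMap (λ x → concatMap (λ y → if b x y then [ h x y ] else []) ys) xs ≡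
  map (uncurry h) (filter (λ e → b (proj₁ e) (proj₂ e) Bool.≟ true) (cartesianProduct xs ys))
filter-cartesianProduct b h []       ys = refl
filter-cartesianProduct b h (x ∷ xs) ys = trans
  (cong₂ _++_ (row ys) (filter-cartesianProduct b h xs ys))
  (trans (sym (Listₚ.map-++ (uncurry h) (filter P? (map (x ,_) ys)) _))
         (cong (map (uncurry h)) (sym (Listₚ.filter-++ P? (map (x ,_) ys) (cartesianProduct xs ys)))))
  where
  P? = λ e → b (proj₁ e) (proj₂ e) Bool.≟ true
  row : ∀ ys → concatMap (λ y → if b x y then [ h x y ] else []) ys ≡ map (uncurry h) (filter P? (map (x ,_) ys))
  row [] = refl
  row (y ∷ ys) with b x y
  ... | true  = cong (h x y ∷_) (row ys)
  ... | false = row ys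

module _ {n} (G : Graph n) where

  private
    isEdge : Fin n → Fin n → Bool
    isEdge u v = (toℕ u ℕ.<ᵇ toℕ v) ∧ adj G u v

  edges : List (Fin n × Fin n)
  edges = filter (λ e → isEdge (proj₁ e) (proj₂ e) Bool.≟ true) (cartesianProduct (allFin n) (allFin n))

  SO≡ : SO G ≡ map (λ e → 1 , ω G e) edges
  SO≡ = filter-cartesianProduct isEdge (λ u v → 1 , ω G (u , v)) (allFin n) (allFin n)

  edges! : Unique edges
  edges! = Uniqueₚ.filter⁺ _ (Uniqueₚ.cartesianProduct⁺ (Uniqueₚ.allFin⁺ n) (Uniqueₚ.allFin⁺ n))

  edges⁻ : ∀ {u v} → (u , v) ∈ edges → toℕ u < toℕ v × Adj G u v
  edges⁻ {u} {v} uv∈ with proj₂ (∈ₚ.∈-filter⁻ (λ e → isEdge (proj₁ e) (proj₂ e) Bool.≟ true)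
                                   {xs = cartesianProduct (allFin n) (allFin n)} uv∈)
  ... | e = ℕₚ.<ᵇ⇒< (toℕ u) (toℕ v) (subst Bool.T (sym (Boolₚ.∧-conicalˡ _ _ e)) _) , Boolₚ.∧-conicalʳ (toℕ u ℕ.<ᵇ toℕ v) _ e

  edges⁺ : ∀ {u v} → toℕ u < toℕ v → Adj G u v → (u , v) ∈ edges
  edges⁺ {u} {v} u<v uv = ∈ₚ.∈-filter⁺ (λ e → isEdge (proj₁ e) (proj₂ e) Bool.≟ true)
    (∈ₚ.∈-cartesianProduct⁺ (∈ₚ.∈-allFin u) (∈ₚ.∈-allFin v)) (cong₂ _∧_ (T⇒≡ (ℕₚ.<⇒<ᵇ u<v)) uv)
    where
    T⇒≡ : ∀ {b} → Bool.T b → b ≡ true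
    T⇒≡ {true} _ = refl

-- Orientation has to be forgotten: `edges` orders endpoints by vertex number, whereas labels are
-- oriented along the cycle or towards the parent.
SamePair : ∀ {A : Set} → A × A → A × A → Set
SamePair (u , v) e = e ≡ (u , v) ⊎ e ≡ (v , u)

-- Upper and lower bounds for the Sombor index

0<ι : ∀ m → 0ℚ ℚ.< ι (suc m)
0<ι m = ℚₚ.≰⇒> λ ι≤0 → contradiction (ι-cancel (subst (ι (suc m) ℚ.≤_) (sym ι0) ι≤0)) λ ()

-- This is `chord` made affine in `x + y`, so that summing over the cycle only requires the total of
-- `ch`. For `k = 0` `chord` reads `0 ≤ 0`; there the radicand is 8, and `p ≤ b` holds directly,
-- with factor 1 instead of `k`.
cycleEdge-bound : ∀ k x y {p a b} → x + y ≤ k →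
  Lower ((2 + x) * (2 + x) + (2 + y) * (2 + y)) p → Upper ((k + 2) * (k + 2) + 4) a → Upper 8 b →
  ι (suc (ℕ.pred k)) ℚ.* p ℚ.≤ ι (suc (ℕ.pred k)) ℚ.* b ℚ.+ ι (x + y) ℚ.* (a ℚ.- b)
cycleEdge-bound zero zero zero {p} {a} {b} z≤n lp ua ub = begin
  ι 1 ℚ.* p                              ≤⟨ *-monoʳ (0≤ι 1) (lower≤upper lp ub) ⟩
  ι 1 ℚ.* b                              ≡⟨ solve 3 (λ i a b → i :* b := i :* b :+ con 0ℚ :* (a :- b)) refl (ι 1) a b ⟩
  ι 1 ℚ.* b ℚ.+ 0ℚ ℚ.* (a ℚ.- b)         ≡⟨ cong (λ z → ι 1 ℚ.* b ℚ.+ z ℚ.* (a ℚ.- b)) (sym ι0) ⟩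
  ι 1 ℚ.* b ℚ.+ ι 0 ℚ.* (a ℚ.- b)        ∎
  where open ℚₚ.≤-Reasoning
        open ℚSolver.+-*-Solver
cycleEdge-bound (suc k) x y {p} {a} {b} x+y≤k lp ua ub = subst
  (λ m → ι m ℚ.* p ℚ.≤ ι m ℚ.* b ℚ.+ ι (x + y) ℚ.* (a ℚ.- b)) k≡ (begin
  ι (x + y + z) ℚ.* p                                  ≤⟨ chord x y z lp (upper-mono (ℕₚ.≤-reflexive (cong (λ m → (m + 2) * (m + 2) + 4) k≡)) ua) ub ⟩
  ι (x + y) ℚ.* a ℚ.+ ι z ℚ.* b                        ≡⟨ solve 4 (λ t z a b → t :* a :+ z :* b := (t :+ z) :* b :+ t :* (a :- b)) refl (ι (x + y)) (ι z) a b ⟩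
  (ι (x + y) ℚ.+ ι z) ℚ.* b ℚ.+ ι (x + y) ℚ.* (a ℚ.- b) ≡⟨ cong (λ m → m ℚ.* b ℚ.+ ι (x + y) ℚ.* (a ℚ.- b)) (ι-+ (x + y) z) ⟨
  ι (x + y + z) ℚ.* b ℚ.+ ι (x + y) ℚ.* (a ℚ.- b)      ∎)
  where
  open ℚₚ.≤-Reasoning
  open ℚSolver.+-*-Solver
  z = suc k ∸ (x + y)
  k≡ : x + y + z ≡ suc k
  k≡ = ℕₚ.m+[n∸m]≡n x+y≤k

upper-⊓ : ∀ {r p q} → Upper r p → Upper r q → Upper r (p ℚ.⊓ q)
upper-⊓ {r} {p} {q} up uq with ℚₚ.≤-total p q
... | inj₁ p≤q = subst (Upper r) (sym (ℚₚ.p≤q⇒p⊓q≡p p≤q)) up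
... | inj₂ q≤p = subst (Upper r) (sym (ℚₚ.p≥q⇒p⊓q≡q q≤p)) uq

cyclePairs! : ∀ {A : Set} {xs : List A} → Unique xs → Unique (cyclePairs xs)
cyclePairs! {xs = []}     _   = []
cyclePairs! {xs = x ∷ xs} xs! = AllPairs.map (λ u≢u′ e≡e′ → u≢u′ (cong proj₁ e≡e′))
  (AllPairsₚ.map⁻ (subst Unique (sym (fsts x xs x)) xs!))
  where
  fsts : ∀ x xs z → map proj₁ (zip (x ∷ xs) (xs ++ [ z ])) ≡ x ∷ xs
  fsts x []       z = refl
  fsts x (y ∷ xs) z = cong (x ∷_) (fsts y xs z)

n≤1+pred : ∀ m → m ≤ suc (ℕ.pred m)
n≤1+pred zero    = z≤n
n≤1+pred (suc m) = ℕₚ.≤-refl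

0≤q-p : ∀ {p q} → p ℚ.≤ q → 0ℚ ℚ.≤ q ℚ.- p
0≤q-p {p} {q} p≤q = subst (ℚ._≤ q ℚ.- p) (ℚₚ.+-inverseʳ p) (ℚₚ.+-monoˡ-≤ (ℚ.- p) p≤q)

samePair-ordered : ∀ {n} {p e e′ : Fin n × Fin n} → SamePair p e → SamePair p e′ →
                   toℕ (proj₁ e) < toℕ (proj₂ e) → toℕ (proj₁ e′) < toℕ (proj₂ e′) → e ≡ e′
samePair-ordered (inj₁ refl) (inj₁ refl) _  _  = refl
samePair-ordered (inj₂ refl) (inj₂ refl) _  _  = refl
samePair-ordered (inj₁ refl) (inj₂ refl) lt gt = contradiction gt (ℕₚ.<-asym lt)
samePair-ordered (inj₂ refl) (inj₁ refl) lt gt = contradiction gt (ℕₚ.<-asym lt)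

module Bounds {n} (G : Graph n) (connected : Connected G)
  (unique-cycle : ∀ vs ws → IsCycle G vs → IsCycle G ws → ∀ u v → CycleEdge vs u v → CycleEdge ws u v)
  (C : List (Fin n)) (C-cycle : IsCycle G C) where

  open Degrees G connected unique-cycle C C-cycle public

  -- Labels for the edges: a pair of consecutive cycle vertices, or a vertex off `C` standing for
  -- the edge to its parent.
  Skeleton : Set
  Skeleton = (Fin n × Fin n) ⊎ Fin n

  skeleton : List Skeleton
  skeleton = map inj₁ (cyclePairs C) ++ map inj₂ off

  endpoints : Skeleton → Fin n × Fin n
  endpoints (inj₁ e) = e
  endpoints (inj₂ v) = v , parent v

  cycle∈skeleton : ∀ {e} → e ∈ cyclePairs C → inj₁ e ∈ skeleton
  cycle∈skeleton e∈ = ∈ₚ.∈-++⁺ˡ (∈ₚ.∈-map⁺ inj₁ e∈)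

  tree∈skeleton : ∀ {v} → v ∉ C → inj₂ v ∈ skeleton
  tree∈skeleton v∉C = ∈ₚ.∈-++⁺ʳ (map inj₁ (cyclePairs C)) (∈ₚ.∈-map⁺ inj₂ (off⁺ v∉C))

  Σℚ-skeleton : ∀ (w : Skeleton → ℚ) → Σℚ w skeleton ≡ Σℚ (w ∘ inj₁) (cyclePairs C) ℚ.+ Σℚ (w ∘ inj₂) off
  Σℚ-skeleton w = trans (Σℚ-++ w (map inj₁ (cyclePairs C)) _)
    (cong₂ ℚ._+_ (Σℚ-map w inj₁ (cyclePairs C)) (Σℚ-map w inj₂ off))

  2+[g-2]≡g : 2 + (length C ∸ 2) ≡ length C
  2+[g-2]≡g = ℕₚ.m+[n∸m]≡n (ℕₚ.≤-trans (s≤s (s≤s z≤n)) 3≤g)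

  -- `R` is the radicand granted to tree edges: `(k+2)²+1` gives `SObound`, and `(k+1)²+4` the
  -- smaller bound available without a hub.
  bound : ℕ → SqrtSum
  bound R = (2 , (k + 2) * (k + 2) + 4) ∷ (k , R) ∷ (2 * (length C ∸ 2) , 2) ∷ []

  -- The last term is regrouped as `g - 2` copies of `2 b`, because the length occurring in `chord`
  -- is `√8 = 2√2`.
  eval-bound : ∀ {P : ℕ → ℚ → Set} {R} a c b {pa pc pb} →
    evalApprox {P} {bound R} ((a , pa) ∷ (c , pc) ∷ (b , pb) ∷ []) ≡
    ι 2 ℚ.* a ℚ.+ (ι k ℚ.* c ℚ.+ ι (length C ∸ 2) ℚ.* (ι 2 ℚ.* b))
  eval-bound a c b rewrite sym (ι≡ 2) | sym (ι≡ k) | sym (ι≡ (2 * (length C ∸ 2))) | ι-* 2 (length C ∸ 2) =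
    solve 6 (λ i k g a c b → i :* a :+ (k :* c :+ (i :* g :* b :+ con 0ℚ)) := i :* a :+ (k :* c :+ g :* (i :* b)))
      refl (ι 2) (ι k) (ι (length C ∸ 2)) a c b
    where open ℚSolver.+-*-Solver

  module _ {R : ℕ} (ω-tree≤R : ∀ {v} → v ∉ C → ω G (v , parent v) ≤ R) where

    SO-bounded : SO G ≤√ bound R
    SO-bounded = subst (_≤√ bound R) (sym (SO≡ G)) bounded
      where
      bounded : SqrtTerms (ω G) {LowerBound} (edges G) ≤√ bound R
      bounded ls ((a , ua′) ∷ (c , uc′) ∷ (b₀ , ub′) ∷ []) = ℚₚ.*-cancelˡ-≤-pos (ι K) {{ℚ.positive (0<ι _)}} (begin
        ι K ℚ.* evalApprox ls                          ≡⟨ cong (ι K ℚ.*_) (tagged-sum (ω G) (edges G) ls) ⟩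
        ι K ℚ.* Σℚ proj₂ T                             ≡⟨ Σℚ-scale proj₂ (ι K) T ⟨
        Σℚ (λ t → ι K ℚ.* proj₂ t) T                   ≤⟨ Σℚ-dominated Charge (λ t → ι K ℚ.* proj₂ t) w (λ r → proj₂ (proj₂ r)) (All.tabulate (λ {y} _ → 0≤w y)) T# T~ ⟩
        Σℚ w skeleton                                  ≡⟨ Σℚ-skeleton w ⟩
        Σℚ (w ∘ inj₁) (cyclePairs C) ℚ.+ Σℚ (w ∘ inj₂) off ≡⟨ cong₂ ℚ._+_ (Σℚ-affine (ι K ℚ.* b) (a ℚ.- b) _ (cyclePairs C)) (Σℚ-const (ι K ℚ.* c) off) ⟩
        ι (length (cyclePairs C)) ℚ.* (ι K ℚ.* b) ℚ.+ ι (sum (map (λ e → ch (proj₁ e) + ch (proj₂ e)) (cyclePairs C))) ℚ.* (a ℚ.- b) ℚ.+ ι (length off) ℚ.* (ι K ℚ.* c)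
          ≡⟨ cong₂ (λ s m → s ℚ.+ ι m ℚ.* (ι K ℚ.* c))
               (cong₂ (λ g x → ι g ℚ.* (ι K ℚ.* b) ℚ.+ ι x ℚ.* (a ℚ.- b))
                  (trans (cyclePairs-length C) (sym 2+[g-2]≡g)) (cyclePairs-sum ch C)) length-off ⟩
        ι (2 + g-2) ℚ.* (ι K ℚ.* b) ℚ.+ ι (2 * sum (map ch C)) ℚ.* (a ℚ.- b) ℚ.+ ι k ℚ.* (ι K ℚ.* c)
          -- The vertices of `C` have at most `k ≤ K` children in all; enlarging the coefficient to
          -- `2 K` is sound because `0 ≤ a - b`.
          ≤⟨ ℚₚ.+-monoˡ-≤ (ι k ℚ.* (ι K ℚ.* c)) (ℚₚ.+-monoʳ-≤ (ι (2 + g-2) ℚ.* (ι K ℚ.* b))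
               (ℚₚ.*-monoʳ-≤-nonNeg (a ℚ.- b) {{ℚ.nonNegative 0≤a-b}} (ι-mono (ℕₚ.*-monoʳ-≤ 2 (ℕₚ.≤-trans (sum-ch≤k C!) k≤K))))) ⟩
        ι (2 + g-2) ℚ.* (ι K ℚ.* b) ℚ.+ ι (2 * K) ℚ.* (a ℚ.- b) ℚ.+ ι k ℚ.* (ι K ℚ.* c)
          ≡⟨ cong₂ (λ s t → s ℚ.* (ι K ℚ.* b) ℚ.+ t ℚ.* (a ℚ.- b) ℚ.+ ι k ℚ.* (ι K ℚ.* c)) (ι-+ 2 g-2) (ι-* 2 K) ⟩
        (ι 2 ℚ.+ ι g-2) ℚ.* (ι K ℚ.* b) ℚ.+ ι 2 ℚ.* ι K ℚ.* (a ℚ.- b) ℚ.+ ι k ℚ.* (ι K ℚ.* c)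
          -- The `2 K b` inside `2 K (a - b)` cancels two of the `g` copies of `K b`, leaving `2 a`
          -- and `g - 2` copies of `b`.
          ≡⟨ solve 7 (λ i g K k a b c → (i :+ g) :* (K :* b) :+ i :* K :* (a :- b) :+ k :* (K :* c) := K :* (i :* a :+ (k :* c :+ g :* b)))
               refl (ι 2) (ι g-2) (ι K) (ι k) a b c ⟩
        ι K ℚ.* (ι 2 ℚ.* a ℚ.+ (ι k ℚ.* c ℚ.+ ι g-2 ℚ.* b))
          ≤⟨ *-monoʳ (0≤ι K) (ℚₚ.+-monoʳ-≤ (ι 2 ℚ.* a) (ℚₚ.+-monoʳ-≤ (ι k ℚ.* c) (*-monoʳ (0≤ι g-2) (ℚₚ.p⊓q≤p (ι 2 ℚ.* b₀) a)))) ⟩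
        ι K ℚ.* (ι 2 ℚ.* a ℚ.+ (ι k ℚ.* c ℚ.+ ι g-2 ℚ.* (ι 2 ℚ.* b₀)))
          ≡⟨ cong (ι K ℚ.*_) (eval-bound {UpperBound} {R} a c b₀ {ua′} {uc′} {ub′}) ⟨
        ι K ℚ.* evalApprox {UpperBound} {bound R} ((a , ua′) ∷ (c , uc′) ∷ (b₀ , ub′) ∷ []) ∎)
        where
        open ℚₚ.≤-Reasoning
        open ℚSolver.+-*-Solver
        g-2 = length C ∸ 2
        -- max k 1, so that K can be cancelled when G is a bare cycle.
        K = suc (ℕ.pred k)
        k≤K : k ≤ K
        k≤K = n≤1+pred k
        ua = toUpper ua′
        uc = toUpper uc′
        -- 2 b₀ may exceed a for poor approximations, and a − b has to be nonnegative.
        b = (ι 2 ℚ.* b₀) ℚ.⊓ a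
        8≤A : 8 ≤ (k + 2) * (k + 2) + 4
        8≤A = ℕₚ.+-monoˡ-≤ 4 (ℕₚ.*-mono-≤ (ℕₚ.m≤n+m 2 k) (ℕₚ.m≤n+m 2 k))
        ub : Upper 8 b
        ub = upper-⊓ (upper-scale 2 (toUpper {2} ub′)) (upper-mono 8≤A ua)
        0≤a-b : 0ℚ ℚ.≤ a ℚ.- b
        0≤a-b = 0≤q-p (ℚₚ.p⊓q≤q (ι 2 ℚ.* b₀) a)
        T = tagged (ω G) (edges G) ls
        w : Skeleton → ℚ
        w (inj₁ (u , v)) = ι K ℚ.* b ℚ.+ ι (ch u + ch v) ℚ.* (a ℚ.- b)
        w (inj₂ _)       = ι K ℚ.* c
        0≤w : ∀ y → 0ℚ ℚ.≤ w y
        0≤w (inj₁ (u , v)) = 0≤+ (0≤* (0≤ι K) (proj₁ ub)) (0≤* (0≤ι (ch u + ch v)) 0≤a-b)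
        0≤w (inj₂ _)       = 0≤* (0≤ι K) (proj₁ uc)
        -- The order of the endpoints is recorded because an unordered pair has only one increasing
        -- representative; hence two edges charged to one label coincide.
        Charge : (Fin n × Fin n) × ℚ → Skeleton → Set
        Charge (e , p) y = SamePair (endpoints y) e × toℕ (proj₁ e) < toℕ (proj₂ e) × ι K ℚ.* p ℚ.≤ w y
        T# : AllPairs (λ t t′ → ∀ y → Charge t y → ¬ Charge t′ y) T
        T# = AllPairs.map (λ e≢e′ y (s , lt , _) (s′ , lt′ , _) → e≢e′ (samePair-ordered s s′ lt lt′))
          (AllPairsₚ.map⁻ (subst Unique (sym (tagged-fst (ω G) (edges G) ls)) (edges! G)))
        cycle-weight : ∀ {u v p} → (u , v) ∈ cyclePairs C → Lower (ω G (u , v)) p → ι K ℚ.* p ℚ.≤ w (inj₁ (u , v))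
        cycle-weight {u} {v} uv∈ lp = cycleEdge-bound k (ch u) (ch v)
          (ch-pair≤k (Adj⇒≢ (cycleEdge-adj (inj₁ uv∈)))) (lower-mono (ω-cycle≤ u v) lp) ua ub
        tree-weight : ∀ {v p} → v ∉ C → Lower (ω G (v , parent v)) p → ι K ℚ.* p ℚ.≤ ι K ℚ.* c
        tree-weight v∉C lp = *-monoʳ (0≤ι K) (lower≤upper (lower-mono (ω-tree≤R v∉C) lp) uc)
        flip : ∀ {u v p} → Lower (ω G (u , v)) p → Lower (ω G (v , u)) p
        flip {u} {v} = lower-mono (ℕₚ.≤-reflexive (ω-comm G u v))
        cover : ∀ {u v p} → toℕ u < toℕ v → Adj G u v → Lower (ω G (u , v)) p → Any (Charge ((u , v) , p)) skeleton
        cover u<v uv lp with edge-cases uv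
        ... | inj₁ (inj₁ uv∈)           = lose (cycle∈skeleton uv∈) (inj₁ refl , u<v , cycle-weight uv∈ lp)
        ... | inj₁ (inj₂ vu∈)           = lose (cycle∈skeleton vu∈) (inj₂ refl , u<v , cycle-weight vu∈ (flip lp))
        ... | inj₂ (inj₁ (u∉C , refl))  = lose (tree∈skeleton u∉C) (inj₁ refl , u<v , tree-weight u∉C lp)
        ... | inj₂ (inj₂ (v∉C , refl))  = lose (tree∈skeleton v∉C) (inj₂ refl , u<v , tree-weight v∉C (flip lp))
        T~ : All (λ t → Any (Charge t) skeleton) T
        T~ = All.tabulate λ {t} t∈ →
          let u<v , uv = edges⁻ G (tagged-∈⁻ (ω G) t∈)
          in cover u<v uv (toLower {ω G (proj₁ t)} (All.lookup (tagged-snd (ω G) (edges G) ls) t∈))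

  -- Sharpness in the presence of a hub

  module _ {w : Fin n} (hub : IsHub w) where

    w∈C : w ∈ C
    w∈C = hub∈C hub

    Valid : Skeleton → Set
    Valid (inj₁ e) = e ∈ cyclePairs C
    Valid (inj₂ v) = v ∉ C

    cycle≢tree : ∀ {p v u e} → p ∈ cyclePairs C → v ∉ C → SamePair p e → ¬ SamePair (v , u) e
    cycle≢tree p∈ v∉C (inj₁ refl) (inj₁ refl) = v∉C (proj₁ (cyclePairs⇒∈ p∈))
    cycle≢tree p∈ v∉C (inj₂ refl) (inj₂ refl) = v∉C (proj₁ (cyclePairs⇒∈ p∈))
    cycle≢tree p∈ v∉C (inj₁ refl) (inj₂ refl) = v∉C (proj₂ (cyclePairs⇒∈ p∈))
    cycle≢tree p∈ v∉C (inj₂ refl) (inj₁ refl) = v∉C (proj₂ (cyclePairs⇒∈ p∈))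

    -- Opposite cycle pairs are excluded by `cyclePairs-asym`. Two tree labels for one edge would
    -- make one of the vertices the parent of the other, but every parent is `w`, which lies on `C`.
    endpoints-injective : ∀ {x x′ e} → Valid x → Valid x′ → SamePair (endpoints x) e → SamePair (endpoints x′) e → x ≡ x′
    endpoints-injective {inj₁ _} {inj₁ _} p p′ (inj₁ refl) (inj₁ refl) = refl
    endpoints-injective {inj₁ _} {inj₁ _} p p′ (inj₂ refl) (inj₂ refl) = refl
    endpoints-injective {inj₁ _} {inj₁ _} p p′ (inj₁ refl) (inj₂ refl) = contradiction p′ (cyclePairs-asym C! 3≤g p)
    endpoints-injective {inj₁ _} {inj₁ _} p p′ (inj₂ refl) (inj₁ refl) = contradiction p′ (cyclePairs-asym C! 3≤g p)
    endpoints-injective {inj₁ _} {inj₂ _} p v∉C s s′ = ⊥-elim (cycle≢tree p v∉C s s′)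
    endpoints-injective {inj₂ _} {inj₁ _} v∉C p s s′ = ⊥-elim (cycle≢tree p v∉C s′ s)
    endpoints-injective {inj₂ v} {inj₂ v′} v∉C v′∉C s s′ = cong inj₂ (same s s′)
      where
      same : ∀ {e} → SamePair (v , parent v) e → SamePair (v′ , parent v′) e → v ≡ v′
      same (inj₁ refl) (inj₁ e) = cong proj₁ e
      same (inj₂ refl) (inj₂ e) = cong proj₂ e
      same (inj₁ refl) (inj₂ e) = contradiction (subst (_∈ C) (sym (trans (cong proj₁ e) (hub-parent hub v′∉C))) w∈C) v∉C
      same (inj₂ refl) (inj₁ e) = contradiction (subst (_∈ C) (sym (trans (cong proj₂ e) (hub-parent hub v′∉C))) w∈C) v∉C

    skeleton! : Unique skeleton
    skeleton! = Uniqueₚ.++⁺ (Uniqueₚ.map⁺ Sumₚ.inj₁-injective (cyclePairs! C!)) (Uniqueₚ.map⁺ Sumₚ.inj₂-injective off!) disjoint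
      where
      disjoint : ∀ {x} → x ∈ map inj₁ (cyclePairs C) × x ∈ map inj₂ off → ⊥
      disjoint (∈₁ , ∈₂) with ∈ₚ.∈-map⁻ inj₁ ∈₁ | ∈ₚ.∈-map⁻ inj₂ ∈₂
      ... | _ , _ , refl | _ , _ , ()

    skeleton-valid : All Valid skeleton
    skeleton-valid = Allₚ.++⁺ (Allₚ.map⁺ (All.tabulate (λ e∈ → e∈))) (Allₚ.map⁺ (All.tabulate off⁻))

    -- Lower bounds on degrees are enough: `k + 2` at `w`, 2 on the rest of `C`, and 1 off `C`.
    bounded-SO : bound ((k + 2) * (k + 2) + 1) ≤√ SO G
    bounded-SO = subst (bound _ ≤√_) (sym (SO≡ G)) bounded
      where
      R = (k + 2) * (k + 2) + 1
      bounded : bound R ≤√ SqrtTerms (ω G) {UpperBound} (edges G)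
      bounded ((a , la′) ∷ (c , lc′) ∷ (b , lb′) ∷ []) us = begin
        evalApprox {LowerBound} {bound R} ((a , la′) ∷ (c , lc′) ∷ (b , lb′) ∷ [])
          ≡⟨ eval-bound {LowerBound} {R} a c b {la′} {lc′} {lb′} ⟩
        ι 2 ℚ.* a ℚ.+ (ι k ℚ.* c ℚ.+ ι g-2 ℚ.* (ι 2 ℚ.* b))
          ≡⟨ solve 6 (λ i g k a b c → i :* a :+ (k :* c :+ g :* b) := (i :+ g) :* b :+ i :* (a :- b) :+ k :* c)
               refl (ι 2) (ι g-2) (ι k) a (ι 2 ℚ.* b) c ⟩
        (ι 2 ℚ.+ ι g-2) ℚ.* (ι 2 ℚ.* b) ℚ.+ ι 2 ℚ.* (a ℚ.- ι 2 ℚ.* b) ℚ.+ ι k ℚ.* c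
          ≡⟨ cong₂ (λ s m → s ℚ.+ ι m ℚ.* c)
               (cong₂ (λ g x → g ℚ.* (ι 2 ℚ.* b) ℚ.+ ι x ℚ.* (a ℚ.- ι 2 ℚ.* b))
                 (trans (sym (ι-+ 2 g-2)) (cong ι (trans 2+[g-2]≡g (sym (cyclePairs-length C)))))
                 -- `w` occurs once in `C`, hence is an end of two cycle edges.
                 (sym (trans (cyclePairs-sum (δ Finₚ._≟_ w) C) (cong (2 *_) (sum-δ-∈ Finₚ._≟_ C! w∈C)))))
               (sym length-off) ⟩
        ι (length (cyclePairs C)) ℚ.* (ι 2 ℚ.* b) ℚ.+ ι (sum (map hubs (cyclePairs C))) ℚ.* (a ℚ.- ι 2 ℚ.* b) ℚ.+ ι (length off) ℚ.* c
          ≡⟨ cong₂ ℚ._+_ (Σℚ-affine (ι 2 ℚ.* b) (a ℚ.- ι 2 ℚ.* b) hubs (cyclePairs C)) (Σℚ-const c off) ⟨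
        Σℚ (weight ∘ inj₁) (cyclePairs C) ℚ.+ Σℚ (weight ∘ inj₂) off
          ≡⟨ Σℚ-skeleton weight ⟨
        Σℚ weight skeleton
          ≤⟨ Σℚ-dominated Charge weight proj₂ (λ r → proj₂ (proj₂ r)) 0≤T skeleton# skeleton~ ⟩
        Σℚ proj₂ T
          ≡⟨ tagged-sum (ω G) (edges G) us ⟨
        evalApprox us ∎
        where
        open ℚₚ.≤-Reasoning
        open ℚSolver.+-*-Solver
        g-2 = length C ∸ 2
        T = tagged (ω G) (edges G) us
        la = toLower {(k + 2) * (k + 2) + 4} la′
        lc = toLower {R} lc′
        lb : Lower 8 (ι 2 ℚ.* b)
        lb = lower-scale 2 (toLower {2} lb′)
        -- Counts the ends at `w`, so that `weight` is `a` on the two cycle edges at `w` and `2 b`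
        -- on the others, in the affine form that `Σℚ-affine` sums.
        hubs : Fin n × Fin n → ℕ
        hubs e = δ Finₚ._≟_ w (proj₁ e) + δ Finₚ._≟_ w (proj₂ e)
        weight : Skeleton → ℚ
        weight (inj₁ e) = ι 2 ℚ.* b ℚ.+ ι (hubs e) ℚ.* (a ℚ.- ι 2 ℚ.* b)
        weight (inj₂ _) = c
        Charge : Skeleton → (Fin n × Fin n) × ℚ → Set
        Charge x (e , q) = Valid x × SamePair (endpoints x) e × weight x ℚ.≤ q
        T-upper : ∀ {t} → t ∈ T → Upper (ω G (proj₁ t)) (proj₂ t)
        T-upper {t} t∈ = toUpper {ω G (proj₁ t)} (All.lookup (tagged-snd (ω G) (edges G) us) t∈)
        0≤T : All (λ t → 0ℚ ℚ.≤ proj₂ t) T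
        0≤T = All.tabulate (λ t∈ → proj₁ (T-upper t∈))
        skeleton# : AllPairs (λ x x′ → ∀ t → Charge x t → ¬ Charge x′ t) skeleton
        skeleton# = AllPairs.map (λ x≢x′ _ (v , s , _) (v′ , s′ , _) → x≢x′ (endpoints-injective v v′ s s′)) skeleton!
        edge∈T : ∀ {u v} → Adj G u v → ∃ λ t → t ∈ T × SamePair (u , v) (proj₁ t) × Upper (ω G (u , v)) (proj₂ t)
        edge∈T {u} {v} uv with ℕₚ.<-cmp (toℕ u) (toℕ v)
        ... | tri< u<v _ _ = let t , t∈ , e = tagged-∈⁺ (ω G) (edges⁺ G u<v uv) in
              t , t∈ , inj₁ e , subst (λ e → Upper (ω G e) (proj₂ t)) e (T-upper t∈)
        ... | tri≈ _ u≡v _ = contradiction (Finₚ.toℕ-injective u≡v) (Adj⇒≢ uv)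
        ... | tri> _ _ v<u = let t , t∈ , e = tagged-∈⁺ (ω G) (edges⁺ G v<u (Adj-sym uv)) in
              t , t∈ , inj₂ e , upper-mono (ℕₚ.≤-reflexive (ω-comm G u v)) (subst (λ e → Upper (ω G e) (proj₂ t)) e (T-upper t∈))
        sq : ∀ {i j} → i ≤ j → i * i ≤ j * j
        sq i≤j = ℕₚ.*-mono-≤ i≤j i≤j
        one : ι 2 ℚ.* b ℚ.+ ι 1 ℚ.* (a ℚ.- ι 2 ℚ.* b) ≡ a
        one = trans (cong (λ i → ι 2 ℚ.* b ℚ.+ i ℚ.* (a ℚ.- ι 2 ℚ.* b)) ι1) (solve 2 (λ a b → b :+ con 1ℚ :* (a :- b) := a) refl a (ι 2 ℚ.* b))
        none : ι 2 ℚ.* b ℚ.+ ι 0 ℚ.* (a ℚ.- ι 2 ℚ.* b) ≡ ι 2 ℚ.* b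
        none = trans (cong (λ i → ι 2 ℚ.* b ℚ.+ i ℚ.* (a ℚ.- ι 2 ℚ.* b)) ι0) (solve 2 (λ a b → b :+ con 0ℚ :* (a :- b) := b) refl a (ι 2 ℚ.* b))
        hub-weight : ∀ {r q} → (k + 2) * (k + 2) + 4 ≤ r → Upper r q → ι 2 ℚ.* b ℚ.+ ι 1 ℚ.* (a ℚ.- ι 2 ℚ.* b) ℚ.≤ q
        hub-weight A≤r uq = subst (ℚ._≤ _) (sym one) (lower≤upper (lower-mono A≤r la) uq)
        plain-weight : ∀ {r q} → 8 ≤ r → Upper r q → ι 2 ℚ.* b ℚ.+ ι 0 ℚ.* (a ℚ.- ι 2 ℚ.* b) ℚ.≤ q
        plain-weight 8≤r uq = subst (ℚ._≤ _) (sym none) (lower≤upper (lower-mono 8≤r lb) uq)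
        cycle-weight : ∀ {u v q} → (u , v) ∈ cyclePairs C → Upper (ω G (u , v)) q → weight (inj₁ (u , v)) ℚ.≤ q
        cycle-weight {u} {v} uv∈ uq with u Finₚ.≟ w | v Finₚ.≟ w
        ... | yes refl | yes refl = contradiction refl (Adj⇒≢ (cycleEdge-adj (inj₁ uv∈)))
        ... | yes refl | no _ = hub-weight (ℕₚ.+-mono-≤ (sq hub) (sq deg-v)) uq
          where deg-v = degree≥2 (proj₂ (cyclePairs⇒∈ uv∈))
        ... | no _ | yes refl = hub-weight (ℕₚ.≤-trans (ℕₚ.+-mono-≤ (sq hub) (sq deg-u)) (ℕₚ.≤-reflexive (ω-comm G v u))) uq
          where deg-u = degree≥2 (proj₁ (cyclePairs⇒∈ uv∈))
        ... | no _ | no _ = plain-weight (ℕₚ.+-mono-≤ (sq deg-u) (sq deg-v)) uq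
          where deg-u = degree≥2 (proj₁ (cyclePairs⇒∈ uv∈))
                deg-v = degree≥2 (proj₂ (cyclePairs⇒∈ uv∈))
        tree-weight : ∀ {v q} → v ∉ C → Upper (ω G (v , parent v)) q → c ℚ.≤ q
        tree-weight {v} v∉C uq = lower≤upper (lower-mono
          (ℕₚ.≤-trans (ℕₚ.+-mono-≤ (sq hub-degree) (sq (degree≥1 G (parent-adj v∉C)))) (ℕₚ.≤-reflexive (ω-comm G (parent v) v))) lc) uq
          where
          hub-degree : k + 2 ≤ degree G (parent v)
          hub-degree = subst (λ u → k + 2 ≤ degree G u) (sym (hub-parent hub v∉C)) hub
        covered : ∀ x → Valid x → Any (Charge x) T
        covered (inj₁ (u , v)) uv∈ with edge∈T (cycleEdge-adj (inj₁ uv∈))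
        ... | t , t∈ , s , uq = lose t∈ (uv∈ , s , cycle-weight uv∈ uq)
        covered (inj₂ v) v∉C with edge∈T (parent-adj v∉C)
        ... | t , t∈ , s , uq = lose t∈ (v∉C , s , tree-weight v∉C uq)
        skeleton~ : All (λ x → Any (Charge x) T) skeleton
        skeleton~ = All.map (λ {x} → covered x) skeleton-valid

-- The extremal graph

zip-snoc : ∀ {A : Set} (x : A) xs y z →
  zip (x ∷ (xs ++ [ y ])) ((xs ++ [ y ]) ++ [ z ]) ≡ zip (x ∷ xs) (xs ++ [ y ]) ++ [ y , z ]
zip-snoc x []        y z = refl
zip-snoc x (x′ ∷ xs) y z = cong ((x , x′) ∷_) (zip-snoc x′ xs y z)

module _ {n} {G : Graph n} where

  -- Moving the first vertex to the end merely moves the first pair of `cyclePairs` to the end.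
  isCycle-rotate₁ : ∀ {x xs} → IsCycle G (x ∷ xs) → IsCycle G (xs ++ [ x ])
  isCycle-rotate₁ {x} {xs} ((x≢ ∷ xs!) , 3≤ , edges) =
    Uniqueₚ.++⁺ xs! ([] ∷ []) (λ { (v∈ , here refl) → All.lookup x≢ v∈ refl }) ,
    subst (3 ≤_) (sym (trans (Listₚ.length-++ xs) (ℕₚ.+-comm (length xs) 1))) 3≤ ,
    pairs xs edges
    where
    pairs : ∀ xs → All (uncurry (Adj G)) (cyclePairs (x ∷ xs)) → All (uncurry (Adj G)) (cyclePairs (xs ++ [ x ]))
    pairs []       es       = es
    pairs (y ∷ ys) (e ∷ es) = subst (All (uncurry (Adj G))) (sym (zip-snoc y ys x y)) (Allₚ.++⁺ es (e ∷ []))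

  isCycle-rotate : ∀ xs ys → IsCycle G (xs ++ ys) → IsCycle G (ys ++ xs)
  isCycle-rotate []       ys c = subst (IsCycle G) (sym (Listₚ.++-identityʳ ys)) c
  isCycle-rotate (x ∷ xs) ys c = subst (IsCycle G) (Listₚ.++-assoc ys [ x ] xs)
    (isCycle-rotate xs (ys ++ [ x ]) (subst (IsCycle G) (Listₚ.++-assoc xs ys [ x ]) (isCycle-rotate₁ c)))

  -- Lets the hub take position 0, where the extremal graph has its pendent edges.
  isCycle-startAt : ∀ {w vs} → w ∈ vs → IsCycle G vs → ∃ λ ws → IsCycle G (w ∷ ws) × length (w ∷ ws) ≡ length vs
  isCycle-startAt {w} w∈ c with ∈ₚ.∈-∃++ w∈
  ... | xs , ys , refl = ys ++ xs , isCycle-rotate xs (w ∷ ys) c ,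
    trans (Listₚ.length-++ (w ∷ ys)) (trans (ℕₚ.+-comm (length (w ∷ ys)) _) (sym (Listₚ.length-++ xs)))

ExtremalEdge : ℕ → ℕ → ℕ → Set
ExtremalEdge g i j =
  (i < g × j < g × (suc i ≡ j ⊎ suc j ≡ i ⊎ (i ≡ 0 × j ≡ g ∸ 1) ⊎ (j ≡ 0 × i ≡ g ∸ 1)))
  ⊎ (i ≡ 0 × g ≤ j) ⊎ (j ≡ 0 × g ≤ i)

-- Assembled connective by connective like `cycleWithPendentsAdj`, so that its `does` reduces to
-- that Boolean and the conversions below need no case analysis.
extremalEdge? : ∀ g i j → Dec (ExtremalEdge g i j)
extremalEdge? g i j =
  (i ℕ.<? g ×-dec j ℕ.<? g ×-dec
     (suc i ℕ.≟ j ⊎-dec suc j ℕ.≟ i ⊎-dec (i ℕ.≟ 0 ×-dec j ℕ.≟ g ∸ 1) ⊎-dec (j ℕ.≟ 0 ×-dec i ℕ.≟ g ∸ 1)))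
  ⊎-dec (i ℕ.≟ 0 ×-dec g ℕ.≤? j) ⊎-dec (j ℕ.≟ 0 ×-dec g ℕ.≤? i)

extremalEdge⁺ : ∀ {g i j} → ExtremalEdge g i j → cycleWithPendentsAdj g i j ≡ true
extremalEdge⁺ {g} {i} {j} = dec-true (extremalEdge? g i j)

extremalEdge⁻ : ∀ {g i j} → cycleWithPendentsAdj g i j ≡ true → ExtremalEdge g i j
extremalEdge⁻ {g} {i} {j} = witness (extremalEdge? g i j)
  where
  witness : ∀ {P : Set} (p? : Dec P) → does p? ≡ true → P
  witness (yes p) _ = p

true⇔true⇒≡ : ∀ {b c} → (b ≡ true → c ≡ true) → (c ≡ true → b ≡ true) → b ≡ c
true⇔true⇒≡ {true}  {c}     f _ = sym (f refl)
true⇔true⇒≡ {false} {false} _ _ = refl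
true⇔true⇒≡ {false} {true}  _ g = g refl

module Extremal {n} (G : Graph n) (connected : Connected G)
  (unique-cycle : ∀ vs ws → IsCycle G vs → IsCycle G ws → ∀ u v → CycleEdge vs u v → CycleEdge ws u v) where

  module _ (w : Fin n) (ws : List (Fin n)) (cycle : IsCycle G (w ∷ ws)) where
    private
      C = w ∷ ws
      g = length C
    open Degrees G connected unique-cycle C cycle

    -- Vertices are numbered by their position in `C ++ off`: the hub gets 0, the cycle `0 … g-1` in
    -- cyclic order, and the vertices off `C`, all of them children of the hub, the rest in any
    -- order.
    hub-first⇒iso : IsHub w → IsoTo G (cycleWithPendentsAdj g)
    hub-first⇒iso hub = mk↔ₛ′ to from to-from from-to , adj≡
      where
      L : List (Fin n)
      L = C ++ off
      index : Fin n → ℕ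
      index v = proj₁ (∈⇒at (∈-C++off v))
      at-index : ∀ v → At L (index v) v
      at-index v = proj₂ (∈⇒at (∈-C++off v))
      index-unique : ∀ {i v} → At L i v → index v ≡ i
      index-unique p = at-injective C++off! (at-index _) p
      length-L : length L ≡ n
      length-L = trans (Listₚ.length-++ C) length-C++off
      index<n : ∀ v → index v < n
      index<n v = subst (index v <_) length-L (at⇒< (at-index v))
      to : Fin n → Fin n
      to v = fromℕ< (index<n v)
      toℕ-to : ∀ v → toℕ (to v) ≡ index v
      toℕ-to v = Finₚ.toℕ-fromℕ< (index<n v)
      entry : (i : Fin n) → ∃ (At L (toℕ i))
      entry i = <⇒at (subst (toℕ i <_) (sym length-L) (Finₚ.toℕ<n i))
      from : Fin n → Fin n
      from i = proj₁ (entry i)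
      to-from : ∀ i → to (from i) ≡ i
      to-from i = Finₚ.toℕ-injective (trans (toℕ-to (from i)) (index-unique (proj₂ (entry i))))
      from-to : ∀ v → from (to v) ≡ v
      from-to v = at-functional (subst (λ i → At L i (from (to v))) (toℕ-to v) (proj₂ (entry (to v)))) (at-index v)
      index-w : index w ≡ 0
      index-w = index-unique here
      ∈C⇒at : ∀ {v} → v ∈ C → At C (index v) v
      ∈C⇒at v∈C with ∈⇒at v∈C
      ... | i , p = subst (λ i → At C i _) (sym (index-unique (at-++ˡ p))) p
      index<g⇒at : ∀ {v} → index v < g → At C (index v) v
      index<g⇒at {v} i<g with <⇒at {xs = C} i<g
      ... | u , p = subst (At C (index v)) (at-functional (at-++ˡ p) (at-index v)) p
      ∉C⇒g≤index : ∀ {v} → v ∉ C → g ≤ index v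
      ∉C⇒g≤index v∉C = ℕₚ.≮⇒≥ λ i<g → v∉C (at⇒∈ (index<g⇒at i<g))
      g≤index⇒∉C : ∀ {v} → g ≤ index v → v ∉ C
      g≤index⇒∉C g≤i v∈C = ℕₚ.<⇒≱ (at⇒< (∈C⇒at v∈C)) g≤i
      index≡0⇒w : ∀ {v} → index v ≡ 0 → v ≡ w
      index≡0⇒w {v} i≡0 = at-functional (subst (λ i → At L i v) i≡0 (at-index v)) here

      next-index : ∀ {u v} → (u , v) ∈ cyclePairs C → index u < g × index v < g × Next g (index u) (index v)
      next-index {u} {v} uv∈ with cyclePairs⇒next uv∈
      ... | i , j , p , q , nx rewrite index-unique (at-++ˡ {ys = off} p) | index-unique (at-++ˡ {ys = off} q) =
        at⇒< p , at⇒< q , nx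
      next⇒adj : ∀ {u v} → index u < g → index v < g → Next g (index u) (index v) → Adj G u v
      next⇒adj u< v< nx = cycleEdge-adj (inj₁ (next⇒cyclePairs (index<g⇒at u<) (index<g⇒at v<) nx))

      adj⇒extremal : ∀ {u v} → Adj G u v → ExtremalEdge g (index u) (index v)
      adj⇒extremal uv with edge-cases uv
      ... | inj₁ (inj₁ uv∈) with next-index uv∈
      ...   | u< , v< , inj₁ e        = inj₁ (u< , v< , inj₁ e)
      ...   | u< , v< , inj₂ (e , z)  = inj₁ (u< , v< , inj₂ (inj₂ (inj₂ (z , ℕₚ.suc-injective e))))
      adj⇒extremal uv | inj₁ (inj₂ vu∈) with next-index vu∈
      ...   | v< , u< , inj₁ e        = inj₁ (u< , v< , inj₂ (inj₁ e))
      ...   | v< , u< , inj₂ (e , z)  = inj₁ (u< , v< , inj₂ (inj₂ (inj₁ (z , ℕₚ.suc-injective e))))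
      adj⇒extremal {u} uv | inj₂ (inj₁ (u∉C , refl)) =
        inj₂ (inj₂ (trans (cong index (hub-parent hub u∉C)) index-w , ∉C⇒g≤index u∉C))
      adj⇒extremal {u} uv | inj₂ (inj₂ (v∉C , refl)) =
        inj₂ (inj₁ (trans (cong index (hub-parent hub v∉C)) index-w , ∉C⇒g≤index v∉C))

      pendent-adj : ∀ {u v} → index u ≡ 0 → g ≤ index v → Adj G v u
      pendent-adj {u} {v} i≡0 g≤i = subst (Adj G v) (trans (hub-parent hub v∉C) (sym (index≡0⇒w i≡0))) (parent-adj v∉C)
        where v∉C = g≤index⇒∉C g≤i

      extremal⇒adj : ∀ {u v} → ExtremalEdge g (index u) (index v) → Adj G u v
      extremal⇒adj (inj₁ (u< , v< , inj₁ e)) = next⇒adj u< v< (inj₁ e)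
      extremal⇒adj (inj₁ (u< , v< , inj₂ (inj₁ e))) = Adj-sym (next⇒adj v< u< (inj₁ e))
      extremal⇒adj (inj₁ (u< , v< , inj₂ (inj₂ (inj₁ (z , e))))) = Adj-sym (next⇒adj v< u< (inj₂ (cong suc e , z)))
      extremal⇒adj (inj₁ (u< , v< , inj₂ (inj₂ (inj₂ (z , e))))) = next⇒adj u< v< (inj₂ (cong suc e , z))
      extremal⇒adj (inj₂ (inj₁ (z , g≤))) = Adj-sym (pendent-adj z g≤)
      extremal⇒adj (inj₂ (inj₂ (z , g≤))) = pendent-adj z g≤

      adj≡ : ∀ u v → adj G u v ≡ cycleWithPendentsAdj g (toℕ (to u)) (toℕ (to v))
      adj≡ u v = trans
        (true⇔true⇒≡ (λ uv → extremalEdge⁺ {g} {index u} {index v} (adj⇒extremal uv))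
                     (λ e → extremal⇒adj (extremalEdge⁻ {g} {index u} {index v} e)))
        (sym (cong₂ (cycleWithPendentsAdj g) (toℕ-to u) (toℕ-to v)))

  module _ (C : List (Fin n)) (C-cycle : IsCycle G C) where
    open Bounds G connected unique-cycle C C-cycle

    iso⇒hub : IsoTo G (cycleWithPendentsAdj (length C)) → ∃ IsHub
    iso⇒hub (f , adj≡) = vertex 0<n , subst (_≤ degree G (vertex 0<n))
        (trans (Listₚ.length-map σ (allFin (2 + k))) (trans (Listₚ.length-tabulate {n = 2 + k} (λ j → j)) (ℕₚ.+-comm 2 k)))
        (degree≥ G (vertex 0<n) (Uniqueₚ.map⁺ σ-injective (Uniqueₚ.allFin⁺ (2 + k))) nbr)
      where
      g = length C
      g≤n : g ≤ n
      g≤n = ≤-by (length off) length-C++off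
      0<n : 0 < n
      0<n = ℕₚ.≤-trans (s≤s z≤n) (ℕₚ.≤-trans 3≤g g≤n)
      vertex : ∀ {i} → i < n → Fin n
      vertex i<n = Inverse.from f (fromℕ< i<n)
      to-vertex : ∀ {i} (i<n : i < n) → toℕ (Inverse.to f (vertex i<n)) ≡ i
      to-vertex i<n = trans (cong toℕ (Inverse.strictlyInverseˡ f _)) (Finₚ.toℕ-fromℕ< i<n)
      1+[g-1]≡g : suc (g ∸ 1) ≡ g
      1+[g-1]≡g = ℕₚ.m+[n∸m]≡n (ℕₚ.≤-trans (s≤s z≤n) 3≤g)
      2≤g-1 : 2 ≤ g ∸ 1
      2≤g-1 = ℕₚ.≤-pred (subst (3 ≤_) (sym 1+[g-1]≡g) 3≤g)
      -- The neighbours of 0 in the extremal graph: 1, then the run from `g ∸ 1` to `n ∸ 1`, which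
      -- joins the other cycle neighbour to the pendent vertices. They are distinct because
      -- `1 < g ∸ 1`.
      label : Fin (2 + k) → ℕ
      label Fin.zero    = 1
      label (Fin.suc j) = g ∸ 1 + toℕ j
      label<n : ∀ j → label j < n
      label<n Fin.zero    = ℕₚ.≤-trans (s≤s (s≤s z≤n)) (ℕₚ.≤-trans 3≤g g≤n)
      label<n (Fin.suc j) = begin
        suc (g ∸ 1) + toℕ j ≡⟨ cong (_+ toℕ j) 1+[g-1]≡g ⟩
        g + toℕ j           ≤⟨ ℕₚ.+-monoʳ-≤ g (ℕₚ.≤-pred (Finₚ.toℕ<n j)) ⟩
        g + k               ≡⟨ ℕₚ.m+[n∸m]≡n g≤n ⟩
        n                   ∎
        where open ℕₚ.≤-Reasoning
      1≢label : ∀ j → 1 ≢ label (Fin.suc j)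
      1≢label j e = ℕₚ.<⇒≢ (ℕₚ.≤-trans 2≤g-1 (ℕₚ.m≤m+n (g ∸ 1) (toℕ j))) e
      label-injective : ∀ {i j} → label i ≡ label j → i ≡ j
      label-injective {Fin.zero}  {Fin.zero}  _ = refl
      label-injective {Fin.zero}  {Fin.suc j} e = contradiction e (1≢label j)
      label-injective {Fin.suc i} {Fin.zero}  e = contradiction (sym e) (1≢label i)
      label-injective {Fin.suc i} {Fin.suc j} e = cong Fin.suc (Finₚ.toℕ-injective (ℕₚ.+-cancelˡ-≡ (g ∸ 1) _ _ e))
      σ : Fin (2 + k) → Fin n
      σ j = vertex (label<n j)
      σ-injective : ∀ {i j} → σ i ≡ σ j → i ≡ j
      σ-injective {i} {j} e = label-injective (trans (sym (to-vertex (label<n i)))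
        (trans (cong (toℕ ∘ Inverse.to f) e) (to-vertex (label<n j))))
      extremal : ∀ j → ExtremalEdge g 0 (label j)
      extremal Fin.zero = inj₁ (ℕₚ.≤-trans (s≤s z≤n) 3≤g , ℕₚ.≤-trans (s≤s (s≤s z≤n)) 3≤g , inj₁ refl)
      extremal (Fin.suc Fin.zero) = inj₁ (ℕₚ.≤-trans (s≤s z≤n) 3≤g ,
        ℕₚ.≤-reflexive (trans (cong suc (ℕₚ.+-identityʳ (g ∸ 1))) 1+[g-1]≡g) ,
        inj₂ (inj₂ (inj₁ (refl , ℕₚ.+-identityʳ (g ∸ 1)))))
      extremal (Fin.suc (Fin.suc j)) = inj₂ (inj₁ (refl ,
        subst (_≤ g ∸ 1 + suc (toℕ j)) 1+[g-1]≡g (subst (suc (g ∸ 1) ≤_) (sym (ℕₚ.+-suc (g ∸ 1) (toℕ j))) (s≤s (ℕₚ.m≤m+n (g ∸ 1) (toℕ j))))))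
      nbr : ∀ {u} → u ∈ map σ (allFin (2 + k)) → Adj G (vertex 0<n) u
      nbr u∈ with ∈ₚ.∈-map⁻ σ {xs = allFin (2 + k)} u∈
      ... | j , _ , refl = trans (adj≡ (vertex 0<n) (σ j))
        (subst₂ (λ x y → cycleWithPendentsAdj g x y ≡ true) (sym (to-vertex 0<n)) (sym (to-vertex (label<n j)))
          (extremalEdge⁺ {g} {0} {label j} (extremal j)))

    -- In a bare cycle `k + 2` is 2, so every cycle vertex would be a hub.
    1≤k : ¬ ∃ IsHub → 1 ≤ k
    1≤k ¬hub = ℕₚ.n≢0⇒n>0 λ k≡0 → ¬hub (_ ,
      subst (λ m → m + 2 ≤ degree G (proj₁ ∃∈C)) (sym k≡0) (degree≥2 (proj₂ ∃∈C)))

    tight⇒hub : bound ((k + 2) * (k + 2) + 1) ≤√ SO G → ∃ IsHub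
    tight⇒hub tight with Finₚ.any? (λ w → k + 2 ℕ.≤? degree G w)
    ... | yes hub = hub
    ... | no ¬hub = contradiction
      (SO-bounded (ω-tree< (1≤k ¬hub) (λ v → ℕₚ.≤-pred (subst (degree G v <_) (ℕₚ.+-suc k 1) (ℕₚ.≰⇒> (λ hub → ¬hub (v , hub)))))))
      (≤√-strict (SO G) (1≤k ¬hub) (gap (1≤k ¬hub)) tight)
      where
      -- The two radicands differ by `2 k`, hence strictly only for positive `k`.
      gap : ∀ {k} → 1 ≤ k → (k + 1) * (k + 1) + 4 < (k + 2) * (k + 2) + 1
      gap {suc m} _ = ≤-by (2 * m + 1) (eq m)
        where
        eq : ∀ m → suc ((suc m + 1) * (suc m + 1) + 4) + (2 * m + 1) ≡ (suc m + 2) * (suc m + 2) + 1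
        eq = solve-∀

    hub⇒iso : ∃ IsHub → IsoTo G (cycleWithPendentsAdj (length C))
    hub⇒iso (w , hub) with isCycle-startAt {G = G} (hub∈C {w} hub) C-cycle
    ... | ws , cycle , len = subst (λ g → IsoTo G (cycleWithPendentsAdj g)) len
      -- `IsHub` depends on the cycle only through its length, which rotation preserves.
      (hub-first⇒iso w ws cycle (subst (λ g → n ∸ g + 2 ≤ degree G w) (sym len) hub))

    theorem : (SO G ≤√ SObound n (length C))
      × ((SO G ≈√ SObound n (length C)) ⇔ IsoTo G (cycleWithPendentsAdj (length C)))
    theorem = SO-bounded ω-tree≤ , mk⇔
      (λ (_ , tight) → hub⇒iso (tight⇒hub tight))
      (λ iso → SO-bounded ω-tree≤ , bounded-SO (proj₂ (iso⇒hub iso)))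

theorem3p4 : (n : ℕ) (G : Graph n) → Unicyclic G →
    (C : List (Fin n)) → IsCycle G C →
    (SO G ≤√ SObound n (length C))
    × ((SO G ≈√ SObound n (length C)) ⇔ IsoTo G (cycleWithPendentsAdj (length C)))
theorem3p4 n G (connected , _ , unique-cycle) =
  Extremal.theorem G connected (λ vs ws vs-cycle ws-cycle u v → proj₁ (unique-cycle vs ws vs-cycle ws-cycle u v))
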